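{- The following Wilf equivalences between patterns of length $4$ over inversion sequences hold: \[ \begin{gathered} 1011 \equiv 1101 \equiv 1110,\\ 2110 \equiv 2101 \equiv 2011,\\ 0221 \equiv 0212,\\ 0312 \equiv 0321,\\ 1102 \equiv 1012,\\ 2201 \equiv 2210,\\ 2301 \equiv 2310,\\ 3201 \equiv 3210. \end{gathered} \] Here $\pi\equiv\sigma$ means that $|\mathbf{I}_n(\pi)|=|\mathbf{I}_n(\sigma)|$ for all $n\ge 1$.
   Context: An inversion sequence of length $n$ is a sequence of integers $e=e_1\cdots e_n$ with $0\le e_i<i$ for all $1\le i\le n$; the set of these is $\mathbf{I}_n$. A pattern is a finite sequence of integers $\pi=\pi_1\cdots\pi_k$ (written as a word, e.g. $1011$ means $(1,0,1,1)$). Two integer sequences of the same length $k$, $\pi$ and $\sigma$, are order isomorphic if for all $i,j\in\{1,\dots,k\}$ the relation ($<$, $=$ or $>$) between $\pi_i$ and $\pi_j$ is the same as that between $\sigma_i$ and $\sigma_j$. A sequence $e$ of length $n$ contains a pattern $\pi$ of length $k$ if there are indices $1\le i_1<\cdots<i_k\le n$ such that $e_{i_1}\cdots e_{i_k}$ is order isomorphic to $\pi$; otherwise $e$ avoids $\pi$. $\mathbf{I}_n(\pi)$ denotes the set of $e\in\mathbf{I}_n$ that avoid $\pi$. -}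

module Defs where

open import Data.Nat.Base using (ℕ; zero; suc; _<_; _>_; _≥_)
import Data.Nat.Properties as ℕ
open import Data.Fin.Base as Fin using (Fin; toℕ; fromℕ; inject₁)
import Data.Fin.Properties as Fin
open import Data.Fin.Relation.Unary.Top using (view; ‵fromℕ; ‵inject₁)
open import Data.List.Base as List using (List; length; filter; upTo; cartesianProductWith)
open import Data.List.Membership.Propositional using (_∈_)
open import Data.List.Membership.Propositional.Properties
  using (∈-cartesianProductWith⁺; ∈-cartesianProductWith⁻; ∈-upTo⁺; ∈-upTo⁻; ∈-filter⁺; ∈-filter⁻)
open import Data.List.Relation.Unary.All as All using ()
open import Data.List.Relation.Unary.AllPairs as AllPairs using ()
open import Data.List.Relation.Unary.Any using (here)
open import Data.List.Relation.Unary.Unique.Propositional using (Unique)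
import Data.List.Relation.Unary.Unique.Propositional.Properties as Unique
open import Data.Product.Base using (∃; _×_; _,_; proj₁; proj₂)
open import Data.Vec.Base using (Vec; []; _∷_; _∷ʳ_; lookup; map; initLast)
open import Data.Vec.Properties using (∷ʳ-injective)
open import Function.Bundles using (_⇔_; mk⇔; Equivalence)
open import Relation.Binary.PropositionalEquality using (_≡_; refl; subst₂)
open import Relation.Nullary using (¬_; Dec)
open import Relation.Nullary.Decidable using (map′; _×-dec_; _→-dec_; ¬?)
open import Relation.Unary using (Decidable)

private
  variable
    k l n : ℕ

-- Positions are 0-based, so the bound e_i < i on the i-th entry (1 ≤ i ≤ n)
-- becomes lookup e i < suc (toℕ i).  The bound 0 ≤ e_i is built into ℕ.
IsInversionSequence : Vec ℕ n → Set
IsInversionSequence e = ∀ i → lookup e i < suc (toℕ i)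

OrderIsomorphic : Vec ℕ k → Vec ℕ k → Set
OrderIsomorphic π σ = ∀ i j →
  (lookup π i < lookup π j ⇔ lookup σ i < lookup σ j) ×
  (lookup π i ≡ lookup π j ⇔ lookup σ i ≡ lookup σ j) ×
  (lookup π i > lookup π j ⇔ lookup σ i > lookup σ j)

StrictlyIncreasing : Vec (Fin n) k → Set
StrictlyIncreasing ι = ∀ i j → i Fin.< j → lookup ι i Fin.< lookup ι j

Contains : Vec ℕ n → Vec ℕ k → Set
Contains {n} {k} e π =
  ∃ λ (ι : Vec (Fin n) k) → StrictlyIncreasing ι × OrderIsomorphic (map (lookup e) ι) π

Avoids : Vec ℕ k → Vec ℕ n → Set
Avoids π e = ¬ Contains e π

private
  _⇔-dec_ : {A B : Set} → Dec A → Dec B → Dec (A ⇔ B)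
  a? ⇔-dec b? = map′ (λ (f , g) → mk⇔ f g) (λ e → Equivalence.to e , Equivalence.from e)
                     ((a? →-dec b?) ×-dec (b? →-dec a?))

  anyVec? : {P : Vec (Fin n) k → Set} → Decidable P → Dec (∃ P)
  anyVec? {k = zero}  P? = map′ ([] ,_) (λ { ([] , p) → p }) (P? [])
  anyVec? {k = suc k} P? =
    map′ (λ (i , ι , p) → i ∷ ι , p) (λ { (i ∷ ι , p) → i , ι , p })
         (Fin.any? λ i → anyVec? λ ι → P? (i ∷ ι))

orderIsomorphic? : (π σ : Vec ℕ k) → Dec (OrderIsomorphic π σ)
orderIsomorphic? π σ = Fin.all? λ i → Fin.all? λ j →
  ((lookup π i ℕ.<? lookup π j) ⇔-dec (lookup σ i ℕ.<? lookup σ j)) ×-dec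
  ((lookup π i ℕ.≟  lookup π j) ⇔-dec (lookup σ i ℕ.≟  lookup σ j)) ×-dec
  ((lookup π i ℕ.>? lookup π j) ⇔-dec (lookup σ i ℕ.>? lookup σ j))

strictlyIncreasing? : (ι : Vec (Fin n) k) → Dec (StrictlyIncreasing ι)
strictlyIncreasing? ι = Fin.all? λ i → Fin.all? λ j →
  (i Fin.<? j) →-dec (lookup ι i Fin.<? lookup ι j)

contains? : (e : Vec ℕ n) (π : Vec ℕ k) → Dec (Contains e π)
contains? e π =
  anyVec? λ ι → strictlyIncreasing? ι ×-dec orderIsomorphic? (map (lookup e) ι) π

avoids? : (π : Vec ℕ k) → Decidable (Avoids {n = n} π)
avoids? π e = ¬? (contains? e π)

-- Finite sets are represented by lists; 𝐈-complete and 𝐈-unique below show that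
-- 𝐈 n lists every inversion sequence of length n exactly once.
𝐈 : (n : ℕ) → List (Vec ℕ n)
𝐈 zero    = List.[ [] ]
𝐈 (suc n) = cartesianProductWith _∷ʳ_ (𝐈 n) (upTo (suc n))

𝐈-avoiding : (n : ℕ) → Vec ℕ k → List (Vec ℕ n)
𝐈-avoiding n π = filter (avoids? π) (𝐈 n)

-- This is a cardinality because 𝐈-avoiding n π has no repetitions
-- (𝐈-avoiding-unique) and its members are the intended ones (𝐈-avoiding-complete).
∣𝐈_⟨_⟩∣ : (n : ℕ) → Vec ℕ k → ℕ
∣𝐈 n ⟨ π ⟩∣ = length (𝐈-avoiding n π)

infix 4 _≡ᵂ_

_≡ᵂ_ : Vec ℕ k → Vec ℕ l → Set
π ≡ᵂ σ = ∀ n → n ≥ 1 → ∣𝐈 n ⟨ π ⟩∣ ≡ ∣𝐈 n ⟨ σ ⟩∣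

private
  lookup-∷ʳ-inject₁ : (e : Vec ℕ n) (a : ℕ) (i : Fin n) → lookup (e ∷ʳ a) (inject₁ i) ≡ lookup e i
  lookup-∷ʳ-inject₁ (x ∷ e) a Fin.zero    = refl
  lookup-∷ʳ-inject₁ (x ∷ e) a (Fin.suc i) = lookup-∷ʳ-inject₁ e a i

  lookup-∷ʳ-fromℕ : (e : Vec ℕ n) (a : ℕ) → lookup (e ∷ʳ a) (fromℕ n) ≡ a
  lookup-∷ʳ-fromℕ []      a = refl
  lookup-∷ʳ-fromℕ (x ∷ e) a = lookup-∷ʳ-fromℕ e a

  ∷ʳ⁺ : {e : Vec ℕ n} {a : ℕ} → IsInversionSequence e → a < suc n → IsInversionSequence (e ∷ʳ a)
  ∷ʳ⁺ {n} {e} {a} inv a≤n i with view i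
  ... | ‵fromℕ rewrite lookup-∷ʳ-fromℕ e a | Fin.toℕ-fromℕ n = a≤n
  ... | ‵inject₁ j rewrite lookup-∷ʳ-inject₁ e a j | Fin.toℕ-inject₁ j = inv j

  ∷ʳ⁻ : (e : Vec ℕ n) (a : ℕ) → IsInversionSequence (e ∷ʳ a) → IsInversionSequence e × a < suc n
  ∷ʳ⁻ {n} e a inv =
    (λ i → subst₂ (λ x y → x < suc y) (lookup-∷ʳ-inject₁ e a i) (Fin.toℕ-inject₁ i) (inv (inject₁ i))) ,
    subst₂ (λ x y → x < suc y) (lookup-∷ʳ-fromℕ e a) (Fin.toℕ-fromℕ n) (inv (fromℕ n))

𝐈-complete : (e : Vec ℕ n) → e ∈ 𝐈 n ⇔ IsInversionSequence e
𝐈-complete e = mk⇔ (sound e) (complete e)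
  where
  sound : ∀ {n} (e : Vec ℕ n) → e ∈ 𝐈 n → IsInversionSequence e
  sound {zero}  []  _ ()
  sound {suc n} e e∈ with ∈-cartesianProductWith⁻ _∷ʳ_ (𝐈 n) (upTo (suc n)) e∈
  ... | e′ , a , e′∈ , a∈ , refl = ∷ʳ⁺ {e = e′} (sound e′ e′∈) (∈-upTo⁻ a∈)

  complete : ∀ {n} (e : Vec ℕ n) → IsInversionSequence e → e ∈ 𝐈 n
  complete {zero}  [] _ = here refl
  complete {suc n} e inv with initLast e
  ... | e′ , a , refl with ∷ʳ⁻ e′ a inv
  ...   | inv′ , a≤n = ∈-cartesianProductWith⁺ _∷ʳ_ (complete e′ inv′) (∈-upTo⁺ a≤n)

𝐈-unique : ∀ n → Unique (𝐈 n)
𝐈-unique zero    = All.[] AllPairs.∷ AllPairs.[]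
𝐈-unique (suc n) =
  Unique.cartesianProductWith⁺ _∷ʳ_ (∷ʳ-injective _ _) (𝐈-unique n) (Unique.upTo⁺ (suc n))

𝐈-avoiding-complete : (π : Vec ℕ k) (e : Vec ℕ n) →
                      e ∈ 𝐈-avoiding n π ⇔ (IsInversionSequence e × Avoids π e)
𝐈-avoiding-complete {n = n} π e = mk⇔
  (λ e∈ → let e∈𝐈 , av = ∈-filter⁻ (avoids? π) {xs = 𝐈 n} e∈
          in Equivalence.to (𝐈-complete e) e∈𝐈 , av)
  (λ (inv , av) → ∈-filter⁺ (avoids? π) (Equivalence.from (𝐈-complete e) inv) av)

𝐈-avoiding-unique : (n : ℕ) (π : Vec ℕ k) → Unique (𝐈-avoiding n π)
𝐈-avoiding-unique n π = Unique.filter⁺ (avoids? π) (𝐈-unique n)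

-- Up to a common least letter in front, each equivalence is between α01β and α10β, where all letters of
-- α and β are at least 1. The levels t (the value playing the role of the letter 1) are treated one at a
-- time. Between the shortest prefix containing α and the shortest suffix containing β at level t, a word
-- avoids α01β at level t exactly when its letters ≤ t begin with all the t's, and α10β exactly when they
-- end with them. Moving the t's among the positions of the letters ≤ t, keeping the smaller letters in
-- order, thus exchanges the two conditions at level t. It does not affect another level a: for a > t no
-- letter above t moves, and for a < t the sequence of letters ≤ a does not change, while the letters > a
-- of an occurrence can be found outside the rearranged part. As α has a letter ≥ 1, the moved t's come
-- after a letter ≥ t, hence at positions that admit the value t. Performing the move for
-- t = 0, …, n − 1 is a bijection between the two avoidance classes.
module Submission where

open import Defs
open import Data.Bool.Base using (Bool; true; false; not)
open import Data.Empty using (⊥)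
open import Data.Fin.Base as Fin using (Fin; zero; suc; toℕ)
open import Data.Fin.Patterns using (0F; 1F; 2F; 3F)
open import Data.List.Base as List using (List; []; _∷_; _++_; length; filter; replicate)
open import Data.List.Membership.Propositional using (_∈_)
open import Data.List.Membership.Propositional.Properties
  using (∈-∃++; ∈-map⁺; ∈-map⁻; ∈-++⁺ˡ; ∈-++⁺ʳ; ∈-++⁻)
open import Data.List.Properties
  using (++-assoc; ++-identityʳ; ++-conicalˡ; ++-conicalʳ; ∷-injective; ∷-injectiveˡ; ∷-injectiveʳ;
         length-map; length-++; filter-++; filter-all; filter-none; filter-idem; filter-accept; filter-reject)
open import Data.List.Relation.Binary.Permutation.Propositional using (_↭_; ↭-refl; ↭-sym; ↭-trans; prep)
open import Data.List.Relation.Binary.Permutation.Propositional.Properties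
  using (All-resp-↭; ↭-length; shift; ++-comm)
open import Data.List.Relation.Binary.Pointwise as Pw using (Pointwise; []; _∷_)
open import Data.List.Relation.Binary.Sublist.Propositional.Properties
  using (filter⁺; filter-⊆; Any-resp-⊆; ∷ˡ⁻)
  renaming (++⁺ to ⊆-++⁺; ++⁺ˡ to ⊆-++⁺ˡ; ++⁺ʳ to ⊆-++⁺ʳ)
open import Data.List.Relation.Unary.All as All using (All; []; _∷_)
open import Data.List.Relation.Unary.All.Properties using (all-filter; ++⁺; replicate⁺)
open import Data.List.Relation.Unary.AllPairs using ([]; _∷_)
open import Data.List.Relation.Unary.Any using (Any; here; there)
import Data.List.Relation.Unary.Any.Properties as Any
open import Data.List.Relation.Unary.Unique.Propositional using (Unique)
import Data.List.Relation.Unary.Unique.Propositional.Properties as Unique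
open import Data.Nat.Base
open import Data.Nat.Properties
open import Data.List.Relation.Binary.Sublist.DecPropositional _≟_
  using (_⊆_; []; _∷_; _∷ʳ_; _⊆?_; ⊆-trans; from∈; to∈)
open import Data.Product.Base using (∃; ∃₂; _×_; _,_; proj₁; proj₂)
open import Data.Sum.Base using (_⊎_; inj₁; inj₂)
open import Data.Unit.Base using (⊤; tt)
open import Data.Vec.Base as Vec using (Vec; []; _∷_; lookup; toList; fromList)
open import Data.Vec.Properties
  using (toList∘fromList; toList-injective; length-toList; lookup-map; cast-is-id)
open import Function.Base using (_∘_; id; case_of_)
open import Function.Bundles using (_⇔_; mk⇔; Equivalence)
open import Level using (0ℓ)
open import Relation.Binary.Core using (Rel)
open import Relation.Binary.Definitions as Binary using (tri<; tri≈; tri>)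
open import Relation.Binary.PropositionalEquality
open import Relation.Nullary using (¬_; yes; no; contradiction)
open import Relation.Nullary.Decidable using (True; toWitness; map′; _×-dec_)
open import Relation.Unary using (Pred; Decidable; U)
open import Relation.Unary.Properties using (∁?)

open Equivalence using (to; from)

-- Minimal prefixes and suffixes, and rewriting the factor between them.

module _ {A : Set} where

  ++-compare : ∀ (x : List A) {r} x′ {r′} → x ++ r ≡ x′ ++ r′ →
               (∃ λ d → x ≡ x′ ++ d × r′ ≡ d ++ r) ⊎ (∃ λ d → x′ ≡ x ++ d × r ≡ d ++ r′)
  ++-compare []      x′       eq = inj₂ (x′ , refl , eq)
  ++-compare (a ∷ x) []       eq = inj₁ (a ∷ x , refl , sym eq)
  ++-compare (a ∷ x) (b ∷ x′) eq with refl , eq′ ← ∷-injective eq with ++-compare x x′ eq′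
  ... | inj₁ (d , refl , q) = inj₁ (d , refl , q)
  ... | inj₂ (d , refl , q) = inj₂ (d , refl , q)

  -- `P` and `Q` will say that the ends contain the outer letters of the pattern, `R` that the
  -- factor between them contains the rest.
  data Between (P Q R : Pred (List A) 0ℓ) (e : List A) : Set where
    split : ∀ u m v → e ≡ u ++ m ++ v → P u → R m → Q v → Between P Q R e

  Between-map : ∀ {P Q R P′ Q′ R′ : Pred (List A) 0ℓ} →
                (∀ {u} → P u → P′ u) → (∀ {u} → Q u → Q′ u) → (∀ {u} → R u → R′ u) →
                ∀ {e} → Between P Q R e → Between P′ Q′ R′ e
  Between-map f g h (split u m v eq p r q) = split u m v eq (f p) (h r) (g q)

  InfixClosed : Pred (List A) 0ℓ → Set
  InfixClosed R = ∀ u {m} v → R m → R (u ++ m ++ v)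

  infix-assoc : ∀ (a b m c d : List A) → a ++ (b ++ m ++ c) ++ d ≡ (a ++ b) ++ m ++ (c ++ d)
  infix-assoc a b m c d = begin
    a ++ (b ++ m ++ c) ++ d   ≡⟨ cong (a ++_) (++-assoc b (m ++ c) d) ⟩
    a ++ b ++ (m ++ c) ++ d   ≡⟨ cong (λ z → a ++ b ++ z) (++-assoc m c d) ⟩
    a ++ b ++ m ++ (c ++ d)   ≡⟨ ++-assoc a b _ ⟨
    (a ++ b) ++ m ++ (c ++ d) ∎
    where open ≡-Reasoning

  -- Two prefixes of one list are comparable: the shorter of `x` and `u` becomes `u′`, and `x′` is
  -- what remains of `x`.
  absorbˡ : ∀ {P : Pred (List A) 0ℓ} {x k w} u → x ++ k ≡ u ++ w → P x → P u →
            ∃₂ λ u′ x′ → ∃ λ d → x ≡ u′ ++ x′ × P u′ × x′ ++ k ≡ d ++ w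
  absorbˡ {x = x} u eq px pu with ++-compare u x (sym eq)
  ... | inj₁ (d , refl , q) = x , [] , d , sym (++-identityʳ x) , px , q
  ... | inj₂ (d , refl , q) = u , d , [] , refl , pu , sym q

  absorbʳ : ∀ {Q : Pred (List A) 0ℓ} {k y v} w → k ++ y ≡ w ++ v → Q y → Q v →
            ∃₂ λ y′ v′ → ∃ λ d → y ≡ y′ ++ v′ × Q v′ × k ++ y′ ≡ w ++ d
  absorbʳ {k = k} {y} {v} w eq qy qv with ++-compare w k (sym eq)
  ... | inj₁ (d , refl , refl) = d , v , [] , refl , qv , sym (++-identityʳ (k ++ d))
  ... | inj₂ (d , refl , q) = [] , y , d , refl , qy , ++-identityʳ (w ++ d)

  -- The ends of an occurrence may reach into `m`. Since `x` and `y` satisfy `P` and `Q` themselves,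
  -- such ends can be cut back to them, and infix closure lets the middle factor grow until it
  -- covers `m`.
  Between-absorb : ∀ {P Q R : Pred (List A) 0ℓ} → InfixClosed R → ∀ {x m y} → P x → Q y →
                   Between P Q R (x ++ m ++ y) →
                   ∃₂ λ u x′ → ∃₂ λ y′ v → x ≡ u ++ x′ × y ≡ y′ ++ v × P u × Q v × R (x′ ++ m ++ y′)
  Between-absorb {P} {Q} {R} closed {x} {m} {y} px qy (split u n v eq pu rn qv)
    with u′ , x′ , d , x≡ , pu′ , eq₁ ← absorbˡ {P = P} u eq px pu
    with y′ , v′ , d′ , y≡ , qv′ , eq₂ ← absorbʳ {Q = Q} {k = x′ ++ m} (d ++ n)
                          (trans (++-assoc x′ m y) (trans eq₁ (sym (++-assoc d n v)))) qy qv
    = u′ , x′ , y′ , v′ , x≡ , y≡ , pu′ , qv′ ,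
      subst R (trans (sym (++-assoc d n d′)) (trans (sym eq₂) (++-assoc x′ m y′))) (closed d d′ rn)

  -- Both conditions refer to the factor alone and not to its surroundings, so they survive any
  -- change of the rest of the word.
  MinPrefix MinSuffix : Pred (List A) 0ℓ → Pred (List A) 0ℓ
  MinPrefix P x = P x × (∀ u v → x ≡ u ++ v → P u → v ≡ [])
  MinSuffix Q y = Q y × (∀ u v → y ≡ u ++ v → Q v → u ≡ [])

  MinPrefix-unique : ∀ {P : Pred (List A) 0ℓ} {x r} x′ {r′} → MinPrefix P x → MinPrefix P x′ →
                     x ++ r ≡ x′ ++ r′ → x ≡ x′ × r ≡ r′
  MinPrefix-unique {x = x} x′ (px , min) (px′ , min′) eq with ++-compare x x′ eq
  ... | inj₁ (d , refl , refl) with refl ← min x′ d refl px′ = ++-identityʳ x′ , refl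
  ... | inj₂ (d , refl , refl) with refl ← min′ x d refl px = sym (++-identityʳ x) , refl

  MinSuffix-unique : ∀ {Q : Pred (List A) 0ℓ} r {y} r′ {y′} → MinSuffix Q y → MinSuffix Q y′ →
                     r ++ y ≡ r′ ++ y′ → r ≡ r′ × y ≡ y′
  MinSuffix-unique r r′ (qy , min) (qy′ , min′) eq with ++-compare r r′ eq
  ... | inj₁ (d , refl , refl) with refl ← min′ d _ refl qy = ++-identityʳ r′ , refl
  ... | inj₂ (d , refl , refl) with refl ← min d _ refl qy′ = sym (++-identityʳ r) , refl

  -- After absorption the ends lie inside `x` and `y`; minimality makes them all of `x` and `y`, so
  -- the middle factor is exactly `m`.
  Between-minimal : ∀ {P Q R : Pred (List A) 0ℓ} → InfixClosed R → ∀ {x m y} →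
                    MinPrefix P x → MinSuffix Q y → Between P Q R (x ++ m ++ y) → R m
  Between-minimal {P} {Q} {R} closed {m = m} (px , minx) (qy , miny) b
    with u , x′ , y′ , v , x≡ , y≡ , pu , qv , r ← Between-absorb {P} {Q} closed px qy b
    with refl ← minx u x′ x≡ pu with refl ← miny y′ v y≡ qv = subst R (++-identityʳ m) r

  minPrefix? : ∀ {P : Pred (List A) 0ℓ} → Decidable P → ∀ e →
               (∃₂ λ x r → e ≡ x ++ r × MinPrefix P x) ⊎ (∀ x r → e ≡ x ++ r → ¬ P x)
  minPrefix? P? e with P? []
  minPrefix? P? e       | yes p = inj₁ ([] , e , refl , p , λ u v eq _ → ++-conicalʳ u v (sym eq))
  minPrefix? P? []      | no ¬p = inj₂ λ { [] r eq → ¬p }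
  minPrefix? {P} P? (a ∷ e) | no ¬p with minPrefix? (P? ∘ (a ∷_)) e
  ... | inj₁ (x , r , refl , px , min) = inj₁ (a ∷ x , r , refl , px , λ where
          []      v eq pu → contradiction pu ¬p
          (b ∷ u) v eq pu → min u v (∷-injectiveʳ eq) (subst (λ z → P (z ∷ u)) (sym (∷-injectiveˡ eq)) pu))
  ... | inj₂ none = inj₂ λ where
          []      r eq → ¬p
          (b ∷ x) r eq px → none x r (∷-injectiveʳ eq) (subst (λ z → P (z ∷ x)) (sym (∷-injectiveˡ eq)) px)

  minSuffix? : ∀ {Q : Pred (List A) 0ℓ} → Decidable Q → ∀ e →
               (∃₂ λ r y → e ≡ r ++ y × MinSuffix Q y) ⊎ (∀ r y → e ≡ r ++ y → ¬ Q y)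
  minSuffix? Q? [] with Q? []
  ... | yes q = inj₁ ([] , [] , refl , q , λ u v eq _ → ++-conicalˡ u v (sym eq))
  ... | no ¬q = inj₂ λ { [] [] eq → ¬q }
  minSuffix? Q? (a ∷ e) with minSuffix? Q? e
  ... | inj₁ (r , y , refl , min) = inj₁ (a ∷ r , y , refl , min)
  ... | inj₂ none with Q? (a ∷ e)
  ...   | yes q = inj₁ ([] , a ∷ e , refl , q , λ where
            []      v eq qv → refl
            (b ∷ u) v eq qv → contradiction qv (none u v (∷-injectiveʳ eq)))
  ...   | no ¬q = inj₂ λ where
            []      y refl → ¬q
            (b ∷ r) y eq   → none r y (∷-injectiveʳ eq)

  filter-cong-infix : ∀ {S : Pred A 0ℓ} (S? : Decidable S) x m m′ {y} → filter S? m ≡ filter S? m′ →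
                      filter S? (x ++ m ++ y) ≡ filter S? (x ++ m′ ++ y)
  filter-cong-infix S? x m m′ {y} m≡m′ = begin
    filter S? (x ++ m ++ y)                     ≡⟨ expand m ⟩
    filter S? x ++ filter S? m ++ filter S? y   ≡⟨ cong (λ z → filter S? x ++ z ++ filter S? y) m≡m′ ⟩
    filter S? x ++ filter S? m′ ++ filter S? y  ≡⟨ expand m′ ⟨
    filter S? (x ++ m′ ++ y)                    ∎
    where
    open ≡-Reasoning
    expand : ∀ m → filter S? (x ++ m ++ y) ≡ filter S? x ++ filter S? m ++ filter S? y
    expand m = trans (filter-++ S? x _) (cong (filter S? x ++_) (filter-++ S? m y))

  module _ {P Q : Pred (List A) 0ℓ} (P? : Decidable P) (Q? : Decidable Q) where

    data Frame (e : List A) : Set where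
      frame : ∀ x m y → e ≡ x ++ m ++ y → MinPrefix P x → MinSuffix Q y → Frame e
      none  : ¬ Between P Q U e → Frame e

    frame? : ∀ e → Frame e
    frame? e with minPrefix? P? e
    ... | inj₂ ¬p = none λ { (split u m v eq p _ _) → ¬p u (m ++ v) eq p }
    ... | inj₁ (x , r , refl , minx) with minSuffix? Q? r
    ...   | inj₁ (m , y , refl , miny) = frame x m y refl minx miny
    ...   | inj₂ ¬q = none λ { (split u m v eq p _ q) → absurd u m v eq p q }
      where
      absurd : ∀ u m v → x ++ r ≡ u ++ m ++ v → P u → Q v → ⊥
      -- No proper prefix of `x` satisfies `P`, so `u` reaches at least to the end of `x`, and `v`
      -- would be a suffix of `r` satisfying `Q`.
      absurd u m v eq p q with ++-compare u x (sym eq)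
      ... | inj₁ (d , refl , r≡) = ¬q (d ++ m) v (trans r≡ (sym (++-assoc d m v))) q
      ... | inj₂ (d , refl , mv≡) with refl ← proj₂ minx u d refl p = ¬q m v (sym mv≡) q

    between : (List A → List A) → List A → List A
    between f e with frame? e
    ... | frame x m y _ _ _ = x ++ f m ++ y
    ... | none _            = e

    -- The frame is unique, so the search must return this one. In particular `x ++ f m ++ y` keeps
    -- the ends `x` and `y`, which makes successive rewritings compose.
    between-frame : ∀ f {x} m {y} → MinPrefix P x → MinSuffix Q y →
                    between f (x ++ m ++ y) ≡ x ++ f m ++ y
    between-frame f {x} m {y} minx miny with frame? (x ++ m ++ y)
    ... | none ¬b = contradiction (split x m y refl (proj₁ minx) tt (proj₁ miny)) ¬b
    ... | frame x′ m′ y′ eq minx′ miny′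
      with refl , eq′ ← MinPrefix-unique x′ minx minx′ eq
      with refl , refl ← MinSuffix-unique m m′ miny miny′ eq′ = refl

    between-none : ∀ f {e} → ¬ Between P Q U e → between f e ≡ e
    between-none f {e} ¬b with frame? e
    ... | none _ = refl
    ... | frame x m y eq minx miny = contradiction (split x m y eq (proj₁ minx) tt (proj₁ miny)) ¬b

    between-cong-∘ : ∀ {f g h} → (∀ m → f (g m) ≡ h m) → ∀ e → between f (between g e) ≡ between h e
    between-cong-∘ {f} {g} {h} fg≡h e with frame? e
    ... | none ¬b = between-none f ¬b
    ... | frame x m y _ minx miny = trans (between-frame f (g m) minx miny)
                                          (cong (λ z → x ++ z ++ y) (fg≡h m))

    between-fixed : ∀ {R : Pred (List A) 0ℓ} {f} → (∀ m → ¬ R m → f m ≡ m) →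
                    ∀ e → ¬ Between P Q R e → between f e ≡ e
    between-fixed fix e ¬b with frame? e
    ... | none _ = refl
    ... | frame x m y refl minx miny =
      cong (λ z → x ++ z ++ y) (fix m λ r → ¬b (split x m y refl (proj₁ minx) r (proj₁ miny)))

    -- With a frame, `Between-minimal` turns any occurrence into `R` for the rewritten middle
    -- factor; without a frame there is no occurrence at all.
    between-avoids : ∀ {R : Pred (List A) 0ℓ} {f} → InfixClosed R → (∀ m → ¬ R (f m)) →
                     ∀ e → ¬ Between P Q R (between f e)
    between-avoids closed av e b with frame? e
    ... | none ¬b = ¬b (Between-map id id _ b)
    ... | frame x m y _ minx miny = av m (Between-minimal closed minx miny b)

    between-pointwise : ∀ {_~_ : A → A → Set} {f} → (∀ {a} → a ~ a) → (∀ m → Pointwise _~_ (f m) m) →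
                        ∀ e → Pointwise _~_ (between f e) e
    between-pointwise rfl f~ e with frame? e
    ... | none _ = Pw.refl rfl
    ... | frame x m y refl _ _ = Pw.++⁺ (Pw.refl rfl {x}) (Pw.++⁺ (f~ m) (Pw.refl rfl))

    between-filter : ∀ {S : Pred A 0ℓ} (S? : Decidable S) {f} → (∀ m → filter S? (f m) ≡ filter S? m) →
                     ∀ e → filter S? (between f e) ≡ filter S? e
    between-filter S? {f} f≡ e with frame? e
    ... | none _ = refl
    ... | frame x m y refl _ _ = filter-cong-infix S? x (f m) m (f≡ m)

-- Replacing the letters of a given kind in place.

module _ {A : Set} {P : Pred A 0ℓ} (P? : Decidable P) where

  -- Writes `w` into the positions that `filter P?` reads; once `w` is exhausted, the remaining
  -- letters are kept.
  refill : List A → List A → List A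
  refill []      w       = []
  refill (x ∷ m) []      = x ∷ m
  refill (x ∷ m) (y ∷ w) with P? x
  ... | yes _ = y ∷ refill m w
  ... | no  _ = x ∷ refill m (y ∷ w)

  refill-filter : ∀ m → refill m (filter P? m) ≡ m
  refill-filter []      = refl
  refill-filter (x ∷ m) with P? x in eq
  ... | yes _ rewrite eq = cong (x ∷_) (refill-filter m)
  ... | no  _ = skip (filter P? m) (refill-filter m)
    where
    skip : ∀ w → refill m w ≡ m → refill (x ∷ m) w ≡ x ∷ m
    skip []      _  = refl
    skip (y ∷ w) eq′ rewrite eq = cong (x ∷_) eq′

  filter-refill : ∀ m {w} → All P w → length w ≡ length (filter P? m) → filter P? (refill m w) ≡ w
  filter-refill []      {[]} _ _ = refl
  filter-refill (x ∷ m) {[]} _ len with filter P? (x ∷ m)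
  ... | [] = refl
  filter-refill (x ∷ m) {y ∷ w} (py ∷ pw) len with P? x
  ... | yes _ = trans (filter-accept P? py) (cong (y ∷_) (filter-refill m pw (suc-injective len)))
  ... | no ¬p = trans (filter-reject P? ¬p) (filter-refill m (py ∷ pw) len)

  -- The letters written first lie in `P`, so the second pass finds the same positions, and by
  -- equality of lengths it overwrites exactly those letters.
  refill-refill : ∀ m {w w′} → All P w → length w ≡ length w′ → refill (refill m w) w′ ≡ refill m w′
  refill-refill []      _ _ = refl
  refill-refill (x ∷ m) {[]} {[]} _ _ = refl
  refill-refill (x ∷ m) {y ∷ w} {y′ ∷ w′} (py ∷ pw) len with P? x in eq
  ... | yes _ with P? y
  ...   | yes _ = cong (y′ ∷_) (refill-refill m pw (suc-injective len))
  ...   | no ¬p = contradiction py ¬p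
  refill-refill (x ∷ m) {y ∷ w} {y′ ∷ w′} (py ∷ pw) len | no _ rewrite eq =
    cong (x ∷_) (refill-refill m (py ∷ pw) len)

  refill-pointwise : ∀ m {w} → All P w → Pointwise (λ a b → a ≡ b ⊎ (P a × P b)) (refill m w) m
  refill-pointwise []      _ = []
  refill-pointwise (x ∷ m) {[]} _ = Pw.refl (inj₁ refl)
  refill-pointwise (x ∷ m) {y ∷ w} (py ∷ pw) with P? x
  ... | yes px = inj₂ (py , px) ∷ refill-pointwise m pw
  ... | no  _  = inj₁ refl ∷ refill-pointwise m (py ∷ pw)

  filter-++-∁-↭ : ∀ w → filter P? w ++ filter (∁? P?) w ↭ w
  filter-++-∁-↭ [] = ↭-refl
  filter-++-∁-↭ (x ∷ w) with P? x
  ... | yes _ = prep x (filter-++-∁-↭ w)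
  ... | no  _ = ↭-trans (shift x (filter P? w) _) (prep x (filter-++-∁-↭ w))

  filter-∁-filter : ∀ w → filter (∁? P?) (filter P? w) ≡ []
  filter-∁-filter w = filter-none (∁? P?) (All.map (λ p ¬p → ¬p p) (all-filter P? w))

  filter-filter-∁ : ∀ w → filter P? (filter (∁? P?) w) ≡ []
  filter-filter-∁ w = filter-none P? (all-filter (∁? P?) w)

module _ {A : Set} {P Q : Pred A 0ℓ} (P? : Decidable P) (Q? : Decidable Q) where

  filter-filter : (∀ {a} → P a → Q a) → ∀ w → filter P? (filter Q? w) ≡ filter P? w
  filter-filter P⊆Q [] = refl
  filter-filter P⊆Q (x ∷ w) with Q? x
  ... | no ¬q = trans (filter-filter P⊆Q w) (sym (filter-reject P? (¬q ∘ P⊆Q)))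
  ... | yes _ with P? x
  ...   | yes _ = cong (x ∷_) (filter-filter P⊆Q w)
  ...   | no  _ = filter-filter P⊆Q w

-- Normal forms that avoid 01 or 10 at one level.

∷∷⊈++ : ∀ {u v : ℕ} as {bs} → All (u ≢_) as → All (v ≢_) bs → ¬ (u ∷ v ∷ [] ⊆ as ++ bs)
∷∷⊈++ []       _         v∉ s = let v∈ = to∈ (∷ˡ⁻ s) in All.lookup v∉ v∈ refl
∷∷⊈++ (a ∷ as) (u≢ ∷ u∉) v∉ (refl ∷ s) = u≢ refl
∷∷⊈++ (a ∷ as) (u≢ ∷ u∉) v∉ (.a ∷ʳ s) = ∷∷⊈++ as u∉ v∉ s

-- `false` encodes 01 and `true` encodes 10, with `x` as the letter 0 and `t` as the letter 1.
pair : Bool → ℕ → ℕ → List ℕ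
pair false x t = x ∷ t ∷ []
pair true  x t = t ∷ x ∷ []

x∈pair : ∀ b {x t} → x ∈ pair b x t
x∈pair false = here refl
x∈pair true  = there (here refl)

t∈pair : ∀ b {x t} → t ∈ pair b x t
t∈pair false = there (here refl)
t∈pair true  = here refl

-- Applied to words with letters at most `t`, where the letters not below `t` are the copies of `t`:
-- in front they leave no 01, at the end no 10.
norm : Bool → ℕ → List ℕ → List ℕ
norm false t w = filter (∁? (_<? t)) w ++ filter (_<? t) w
norm true  t w = filter (_<? t) w ++ filter (∁? (_<? t)) w

norm-↭ : ∀ b t w → norm b t w ↭ w
norm-↭ true  t w = filter-++-∁-↭ (_<? t) w
norm-↭ false t w = ↭-trans (++-comm (filter (∁? (_<? t)) w) _) (filter-++-∁-↭ (_<? t) w)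

filter-norm : ∀ b t w → filter (_<? t) (norm b t w) ≡ filter (_<? t) w
filter-norm true t w = trans (filter-++ (_<? t) (filter (_<? t) w) _)
  (trans (cong₂ _++_ (filter-idem (_<? t) w) (filter-filter-∁ (_<? t) w)) (++-identityʳ _))
filter-norm false t w = trans (filter-++ (_<? t) (filter (∁? (_<? t)) w) _)
  (cong₂ _++_ (filter-filter-∁ (_<? t) w) (filter-idem (_<? t) w))

filter-∁-norm : ∀ b t w → filter (∁? (_<? t)) (norm b t w) ≡ filter (∁? (_<? t)) w
filter-∁-norm true t w = trans (filter-++ (∁? (_<? t)) (filter (_<? t) w) _)
  (cong₂ _++_ (filter-∁-filter (_<? t) w) (filter-idem (∁? (_<? t)) w))
filter-∁-norm false t w = trans (filter-++ (∁? (_<? t)) (filter (∁? (_<? t)) w) _)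
  (trans (cong₂ _++_ (filter-idem (∁? (_<? t)) w) (filter-∁-filter (_<? t) w)) (++-identityʳ _))

-- A normal form depends only on the subsequence below `t` and on the complementary one, and
-- normalizing preserves both.
norm-norm : ∀ b b′ t w → norm b t (norm b′ t w) ≡ norm b t w
norm-norm true  b′ t w = cong₂ _++_ (filter-norm b′ t w) (filter-∁-norm b′ t w)
norm-norm false b′ t w = cong₂ _++_ (filter-∁-norm b′ t w) (filter-norm b′ t w)

-- The first letter of the pair is absent from the first block, the second letter from the second
-- block.
norm-avoids : ∀ b {x t} w → x < t → ¬ (pair b x t ⊆ norm b t w)
norm-avoids false {x} {t} w x<t = ∷∷⊈++ _
  (All.map (λ { a≮t refl → a≮t x<t }) (all-filter (∁? (_<? t)) w))
  (All.map (λ { a<t refl → <-irrefl refl a<t }) (all-filter (_<? t) w))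
norm-avoids true {x} {t} w x<t = ∷∷⊈++ _
  (All.map (λ { a<t refl → <-irrefl refl a<t }) (all-filter (_<? t) w))
  (All.map (λ { a≮t refl → a≮t x<t }) (all-filter (∁? (_<? t)) w))

norm-fixed : ∀ b {t w} → All (_≤ t) w → (∀ {x} → x < t → ¬ (pair b x t ⊆ w)) → norm b t w ≡ w
norm-fixed true  [] av = refl
norm-fixed false [] av = refl
norm-fixed true {t} {x ∷ w} (x≤t ∷ w≤t) av with x <? t
... | yes x<t rewrite filter-accept (_<? t) {xs = w} x<t
                  | filter-reject (∁? (_<? t)) {xs = w} (λ x≮t → x≮t x<t) =
  cong (x ∷_) (norm-fixed true w≤t (λ y<t s → av y<t (x ∷ʳ s)))
... | no x≮t rewrite filter-reject (_<? t) {xs = w} x≮t | filter-accept (∁? (_<? t)) {xs = w} x≮t =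
  cong₂ (λ u v → u ++ x ∷ v) (filter-none (_<? t) w≮t) (filter-all (∁? (_<? t)) w≮t)
  where
  w≮t : All (λ y → ¬ y < t) w
  -- Here `x` is `t`, so a later letter below `t` would form 10 with it.
  w≮t with refl ← ≤∧≮⇒≡ x≤t x≮t = All.tabulate λ y∈ y<t → av y<t (refl ∷ from∈ y∈)
norm-fixed false {t} {x ∷ w} (x≤t ∷ w≤t) av with x <? t
... | no x≮t rewrite filter-reject (_<? t) {xs = w} x≮t | filter-accept (∁? (_<? t)) {xs = w} x≮t =
  cong (x ∷_) (norm-fixed false w≤t (λ y<t s → av y<t (x ∷ʳ s)))
... | yes x<t rewrite filter-accept (_<? t) {xs = w} x<t
                  | filter-reject (∁? (_<? t)) {xs = w} (λ x≮t → x≮t x<t) =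
  cong₂ (λ u v → u ++ x ∷ v) (filter-none (∁? (_<? t)) (All.map (λ y<t y≮t → y≮t y<t) w<t))
                             (filter-all (_<? t) w<t)
  where
  w<t : All (_< t) w
  -- Here `x` is below `t`, so a later `t` would form 01 with it.
  w<t = All.tabulate λ y∈ → ≤∧≢⇒< (All.lookup w≤t y∈) λ { refl → av x<t (refl ∷ from∈ y∈) }

-- Subsequences, letterwise relations, and the search for a shape.

⊆-filter : ∀ {P : Pred ℕ 0ℓ} (P? : Decidable P) {z e} → All P z → z ⊆ e → z ⊆ filter P? e
⊆-filter P? pz s = subst (_⊆ _) (filter-all P? pz) (filter⁺ P? P? (λ { refl → id }) s)

++-⊆-split : ∀ (g : List ℕ) {h e} → g ++ h ⊆ e → ∃₂ λ e₁ e₂ → e ≡ e₁ ++ e₂ × g ⊆ e₁ × h ⊆ e₂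
++-⊆-split []      {e = e} s = [] , e , refl , [] , s
++-⊆-split (a ∷ g) (b ∷ʳ s) with e₁ , e₂ , refl , s₁ , s₂ ← ++-⊆-split (a ∷ g) s =
  b ∷ e₁ , e₂ , refl , b ∷ʳ s₁ , s₂
++-⊆-split (a ∷ g) (refl ∷ s) with e₁ , e₂ , refl , s₁ , s₂ ← ++-⊆-split g s =
  a ∷ e₁ , e₂ , refl , refl ∷ s₁ , s₂

Pointwise-++-split : ∀ {A : Set} {_~_ : A → A → Set} u {w e} → Pointwise _~_ (u ++ w) e →
                     ∃₂ λ u′ w′ → e ≡ u′ ++ w′ × Pointwise _~_ u u′ × Pointwise _~_ w w′
Pointwise-++-split []      {e = e} r = [] , e , refl , [] , r
Pointwise-++-split (a ∷ u) (_∷_ {y = b} r rs) with u′ , w′ , refl , r₁ , r₂ ← Pointwise-++-split u rs =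
  b ∷ u′ , w′ , refl , r ∷ r₁ , r₂

⊆-Pointwise : ∀ {_~_ : ℕ → ℕ → Set} {z e e′} → z ⊆ e → Pointwise _~_ e e′ →
              ∃ λ z′ → z′ ⊆ e′ × Pointwise _~_ z z′
⊆-Pointwise []         []       = [] , [] , []
⊆-Pointwise (_ ∷ʳ s)   (_ ∷ rs) with z′ , s′ , q ← ⊆-Pointwise s rs = z′ , _ ∷ʳ s′ , q
⊆-Pointwise (refl ∷ s) (r ∷ rs) with z′ , s′ , q ← ⊆-Pointwise s rs = _ , refl ∷ s′ , r ∷ q

Between-Pointwise : ∀ {A : Set} {_~_ : A → A → Set} {P Q R : Pred (List A) 0ℓ} →
                    (∀ {u u′} → Pointwise _~_ u u′ → P u → P u′) →
                    (∀ {u u′} → Pointwise _~_ u u′ → Q u → Q u′) →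
                    (∀ {u u′} → Pointwise _~_ u u′ → R u → R u′) →
                    ∀ {e e′} → Pointwise _~_ e e′ → Between P Q R e → Between P Q R e′
Between-Pointwise p q r ps (split u m v refl pu rm qv)
  with u′ , _ , refl , u~ , mv~ ← Pointwise-++-split u ps
  with m′ , v′ , refl , m~ , v~ ← Pointwise-++-split m mv~ =
  split u′ m′ v′ refl (p u~ pu) (r m~ rm) (q v~ qv)

Between-infixClosed : ∀ {A : Set} {P Q R : Pred (List A) 0ℓ} →
                      (∀ u {x} → P x → P (u ++ x)) → (∀ {y} v → Q y → Q (y ++ v)) →
                      InfixClosed (Between P Q R)
Between-infixClosed p q a d (split b m c refl pb rm qc) =
  split (a ++ b) m (c ++ d) (infix-assoc a b m c d) (p a pb) rm (q d qc)

anySublist? : ∀ {S : Pred (List ℕ) 0ℓ} → Decidable S → Decidable (λ e → ∃ λ g → g ⊆ e × S g)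
anySublist? S? [] with S? []
... | yes s = yes ([] , [] , s)
... | no ¬s = no λ { ([] , [] , s) → ¬s s }
anySublist? S? (x ∷ e) with anySublist? S? e | anySublist? (S? ∘ (x ∷_)) e
... | yes (g , g⊆ , s) | _ = yes (g , x ∷ʳ g⊆ , s)
... | no _  | yes (g , g⊆ , s) = yes (x ∷ g , refl ∷ g⊆ , s)
... | no ¬p | no ¬q = no λ where
        (g , _ ∷ʳ g⊆ , s)       → ¬p (g , g⊆ , s)
        (_ ∷ g , refl ∷ g⊆ , s) → ¬q (g , g⊆ , s)

-- Inversion sequences as lists, and comparison of cardinalities.

Bounded : ℕ → List ℕ → Set
Bounded k []      = ⊤
Bounded k (x ∷ e) = x ≤ k × Bounded (suc k) e

Bounded-< : ∀ {k x} e → Bounded k e → x ∈ e → x < k + length e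
Bounded-< {k} (y ∷ e) (y≤k , bd) (here refl) = ≤-<-trans y≤k (m<m+n k z<s)
Bounded-< {k} {x} (y ∷ e) (y≤k , bd) (there x∈) =
  subst (x <_) (sym (+-suc k (length e))) (Bounded-< e bd x∈)

Invseq : ℕ → Pred (List ℕ) 0ℓ
Invseq n e = length e ≡ n × Bounded 0 e

<ᵇ-self : ∀ s → (s <ᵇ s) ≡ false
<ᵇ-self zero    = refl
<ᵇ-self (suc s) = <ᵇ-self s

<ᵇ-suc-self : ∀ s → (s <ᵇ suc s) ≡ true
<ᵇ-suc-self zero    = refl
<ᵇ-suc-self (suc s) = <ᵇ-suc-self s

<ᵇ-suc : ∀ {a s} → a ≢ s → (a <ᵇ suc s) ≡ (a <ᵇ s)
<ᵇ-suc {zero}  {zero}  a≢s = contradiction refl a≢s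
<ᵇ-suc {zero}  {suc s} a≢s = refl
<ᵇ-suc {suc a} {zero}  a≢s = refl
<ᵇ-suc {suc a} {suc s} a≢s = <ᵇ-suc (a≢s ∘ cong suc)

<ᵇ-true : ∀ {a n} → a < n → (a <ᵇ n) ≡ true
<ᵇ-true {zero}  (s≤s _)   = refl
<ᵇ-true {suc a} (s≤s a<n) = <ᵇ-true a<n

Unique-length-≤ : ∀ {A : Set} {xs ys : List A} → Unique xs → (∀ {x} → x ∈ xs → x ∈ ys) →
                  length xs ≤ length ys
Unique-length-≤ {xs = []}     _          _   = z≤n
Unique-length-≤ {xs = x ∷ xs} (x∉ ∷ uniq) xs⊆ with ys₁ , ys₂ , refl ← ∈-∃++ (xs⊆ (here refl)) = begin
  suc (length xs)               ≤⟨ s≤s (Unique-length-≤ uniq rest) ⟩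
  suc (length (ys₁ ++ ys₂))     ≡⟨ cong suc (length-++ ys₁) ⟩
  suc (length ys₁ + length ys₂) ≡⟨ +-suc (length ys₁) _ ⟨
  length ys₁ + length (x ∷ ys₂) ≡⟨ length-++ ys₁ ⟨
  length (ys₁ ++ x ∷ ys₂)       ∎
  where
  open ≤-Reasoning
  rest : ∀ {y} → y ∈ xs → y ∈ ys₁ ++ ys₂
  rest y∈ with ∈-++⁻ ys₁ (xs⊆ (there y∈))
  ... | inj₁ y∈₁         = ∈-++⁺ˡ y∈₁
  ... | inj₂ (here refl) = contradiction refl (All.lookup x∉ y∈)
  ... | inj₂ (there y∈₂) = ∈-++⁺ʳ ys₁ y∈₂

-- From vectors and positions to lists and subsequences; pattern occurrences.

IsInversionSequence⇒Bounded : ∀ {n} k (e : Vec ℕ n) →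
                              (∀ i → lookup e i < suc (k + toℕ i)) → Bounded k (toList e)
IsInversionSequence⇒Bounded k []      inv = tt
IsInversionSequence⇒Bounded k (x ∷ e) inv = subst (x ≤_) (+-identityʳ k) (s≤s⁻¹ (inv zero)) ,
  IsInversionSequence⇒Bounded (suc k) e (λ i → subst (λ z → lookup e i < suc z) (+-suc k (toℕ i)) (inv (suc i)))

Bounded⇒IsInversionSequence : ∀ {n} k (e : Vec ℕ n) → Bounded k (toList e) → ∀ i → lookup e i < suc (k + toℕ i)
Bounded⇒IsInversionSequence k (x ∷ e) (x≤k , bd) zero    = s≤s (subst (x ≤_) (sym (+-identityʳ k)) x≤k)
Bounded⇒IsInversionSequence k (x ∷ e) (x≤k , bd) (suc i) =
  subst (λ z → lookup e i < suc z) (sym (+-suc k (toℕ i))) (Bounded⇒IsInversionSequence (suc k) e bd i)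

toVec : ∀ {n} (l : List ℕ) → length l ≡ n → ∃ λ (e : Vec ℕ n) → toList e ≡ l
toVec l refl = fromList l , toList∘fromList l

toList-inj : ∀ {n} {e e′ : Vec ℕ n} → toList e ≡ toList e′ → e ≡ e′
toList-inj {e = e} {e′} eq = trans (sym (cast-is-id refl e)) (toList-injective refl e e′ eq)

StrictlyIncreasing-tail : ∀ {n k i} {ι : Vec (Fin n) k} → StrictlyIncreasing (i ∷ ι) → StrictlyIncreasing ι
StrictlyIncreasing-tail inc i j i<j = inc (suc i) (suc j) (s≤s i<j)

lower : ∀ {n k} (ι : Vec (Fin (suc n)) k) → (∀ j → 0 < toℕ (lookup ι j)) → ∃ λ ι′ → ι ≡ Vec.map suc ι′
lower []          pos = [] , refl
lower (zero ∷ ι)  pos = contradiction (pos zero) λ ()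
lower (suc i ∷ ι) pos with ι′ , refl ← lower ι (pos ∘ suc) = i ∷ ι′ , refl

unsuc-inc : ∀ {n k} (ι : Vec (Fin n) k) → StrictlyIncreasing (Vec.map suc ι) → StrictlyIncreasing ι
unsuc-inc ι inc i j i<j
  with s≤s lt ← subst₂ Fin._<_ (lookup-map i suc ι) (lookup-map j suc ι) (inc i j i<j) = lt

suc-inc : ∀ {n k} (ι : Vec (Fin n) k) → StrictlyIncreasing ι → StrictlyIncreasing (Vec.map suc ι)
suc-inc ι inc i j i<j =
  subst₂ Fin._<_ (sym (lookup-map i suc ι)) (sym (lookup-map j suc ι)) (s≤s (inc i j i<j))

map-lookup-suc : ∀ {n k x} (e : Vec ℕ n) (ι : Vec (Fin n) k) →
                 Vec.map (lookup (x ∷ e)) (Vec.map suc ι) ≡ Vec.map (lookup e) ι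
map-lookup-suc e []      = refl
map-lookup-suc e (i ∷ ι) = cong (_ ∷_) (map-lookup-suc e ι)

positions⇒⊆ : ∀ {n k} (e : Vec ℕ n) (ι : Vec (Fin n) k) → StrictlyIncreasing ι →
              toList (Vec.map (lookup e) ι) ⊆ toList e
positions⇒⊆ []      []  inc = []
positions⇒⊆ (x ∷ e) []  inc = x ∷ʳ positions⇒⊆ e [] λ ()
positions⇒⊆ (x ∷ e) (suc i ∷ ι) inc with ι′ , refl ← lower ι (λ j → ≤-<-trans z≤n (inc zero (suc j) z<s)) =
  x ∷ʳ subst (λ z → lookup e i ∷ toList z ⊆ toList e) (sym (map-lookup-suc e ι′))
         (positions⇒⊆ e (i ∷ ι′) (unsuc-inc (i ∷ ι′) inc))
positions⇒⊆ (x ∷ e) (zero ∷ ι) inc with ι′ , refl ← lower ι (λ j → inc zero (suc j) z<s) =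
  refl ∷ subst (λ z → toList z ⊆ toList e) (sym (map-lookup-suc e ι′))
           (positions⇒⊆ e ι′ (unsuc-inc ι′ (StrictlyIncreasing-tail inc)))

⊆⇒positions : ∀ {n k} (e : Vec ℕ n) (z : Vec ℕ k) → toList z ⊆ toList e →
              ∃ λ ι → StrictlyIncreasing ι × Vec.map (lookup e) ι ≡ z
⊆⇒positions []      []      []       = [] , (λ ()) , refl
⊆⇒positions (x ∷ e) []      _        = [] , (λ ()) , refl
⊆⇒positions (x ∷ e) (y ∷ z) (_ ∷ʳ s) with ι , inc , eq ← ⊆⇒positions e (y ∷ z) s =
  Vec.map suc ι , suc-inc ι inc , trans (map-lookup-suc e ι) eq
⊆⇒positions (x ∷ e) (_ ∷ z) (refl ∷ s) with ι , inc , refl ← ⊆⇒positions e z s =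
  zero ∷ Vec.map suc ι , inc′ , cong (x ∷_) (map-lookup-suc e ι)
  where
  inc′ : StrictlyIncreasing (zero ∷ Vec.map suc ι)
  inc′ zero    (suc j) _         = subst (λ i → 0 < toℕ i) (sym (lookup-map j suc ι)) z<s
  inc′ (suc i) (suc j) (s≤s i<j) = suc-inc ι inc i j i<j

-- For a concrete pattern the implicit `True` arguments are solved by computation, so comparisons of
-- letters are read off as `lt i j` and `eq i j`.
record Occurrence {k} (π : Vec ℕ k) (e : List ℕ) : Set where
  constructor occurrence
  field
    letters   : Vec ℕ k
    letters⊆e : toList letters ⊆ e
    lt        : ∀ i j {_ : True (lookup π i <? lookup π j)} → lookup letters i < lookup letters j
    eq        : ∀ i j {_ : True (lookup π i ≟ lookup π j)} → lookup letters i ≡ lookup letters j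

Contains⇒Occurrence : ∀ {n k} {e : Vec ℕ n} {π : Vec ℕ k} → Contains e π → Occurrence π (toList e)
Contains⇒Occurrence {e = e} (ι , inc , iso) = occurrence (Vec.map (lookup e) ι) (positions⇒⊆ e ι inc)
  (λ i j {π<} → from (proj₁ (iso i j)) (toWitness π<))
  (λ i j {π≡} → from (proj₁ (proj₂ (iso i j))) (toWitness π≡))

StrictMono : (ℕ → ℕ) → Set
StrictMono f = ∀ {i j} → i < j → f i < f j

-- By trichotomy a strictly increasing `f` also reflects `<` and `≡`. To exhibit a pattern it thus
-- suffices to relabel its letters increasingly.
map-iso : ∀ {k f} → StrictMono f → (π : Vec ℕ k) → OrderIsomorphic (Vec.map f π) π
map-iso {f = f} mono π i j rewrite lookup-map i f π | lookup-map j f π =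
  mk⇔ (reflect (lookup π i) (lookup π j)) mono ,
  mk⇔ reflect≡ (cong f) ,
  mk⇔ (reflect (lookup π j) (lookup π i)) mono
  where
  reflect : ∀ a b → f a < f b → a < b
  reflect a b fa<fb with <-cmp a b
  ... | tri< a<b _ _  = a<b
  ... | tri≈ _ refl _ = contradiction fa<fb (<-irrefl refl)
  ... | tri> _ _ b<a  = contradiction (mono b<a) (<-asym fa<fb)
  reflect≡ : ∀ {a b} → f a ≡ f b → a ≡ b
  reflect≡ {a} {b} fa≡fb with <-cmp a b
  ... | tri< a<b _ _ = contradiction fa≡fb (<⇒≢ (mono a<b))
  ... | tri≈ _ a≡b _ = a≡b
  ... | tri> _ _ b<a = contradiction (sym fa≡fb) (<⇒≢ (mono b<a))

⊆⇒Contains : ∀ {n k f} {e : Vec ℕ n} (π : Vec ℕ k) → StrictMono f →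
             toList (Vec.map f π) ⊆ toList e → Contains e π
⊆⇒Contains {f = f} {e} π mono s with ι , inc , eq ← ⊆⇒positions e (Vec.map f π) s =
  ι , inc , subst (λ z → OrderIsomorphic z π) (sym eq) (map-iso mono π)

-- The values of the pattern letters 0 to 3, continued by unit steps so that the relabelling is
-- strictly increasing on all of `ℕ`.
chain : ℕ → ℕ → ℕ → ℕ → ℕ → ℕ
chain x₀ x₁ x₂ x₃ 0 = x₀
chain x₀ x₁ x₂ x₃ 1 = x₁
chain x₀ x₁ x₂ x₃ 2 = x₂
chain x₀ x₁ x₂ x₃ (suc (suc (suc k))) = k + x₃

chain-mono : ∀ {x₀ x₁ x₂ x₃} → x₀ < x₁ → x₁ < x₂ → x₂ < x₃ → StrictMono (chain x₀ x₁ x₂ x₃)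
chain-mono {x₀} {x₁} {x₂} {x₃} a b c {i} i<j = go (≤⇒≤′ i<j)
  where
  up : ∀ i → chain x₀ x₁ x₂ x₃ i < chain x₀ x₁ x₂ x₃ (suc i)
  up 0 = a
  up 1 = b
  up 2 = c
  up (suc (suc (suc k))) = ≤-refl
  go : ∀ {j} → suc i ≤′ j → chain x₀ x₁ x₂ x₃ i < chain x₀ x₁ x₂ x₃ j
  go ≤′-refl = up i
  go (≤′-step {n = m} le) = <-trans (go le) (up m)

record Represents {k} (Occ : ℕ → Pred (List ℕ) 0ℓ) (π : Vec ℕ k) : Set where
  constructor mkRepresents
  field
    contains⇔ : ∀ {n} (e : Vec ℕ n) → IsInversionSequence e →
                Contains e π ⇔ (∃ λ a → Occ a (toList e))

open Represents

-- The first entry of an inversion sequence is 0. A subsequence starting with a positive letter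
-- cannot use it, so it is free to serve as leading 0.
prepend-zero : ∀ {n y w} (e : Vec ℕ n) → IsInversionSequence e → 0 < y →
               y ∷ w ⊆ toList e → 0 ∷ y ∷ w ⊆ toList e
prepend-zero (x ∷ e) inv 0<y s with inv zero
prepend-zero (.0 ∷ e) inv () (refl ∷ s) | s≤s z≤n
prepend-zero (.0 ∷ e) inv 0<y (_ ∷ʳ s)  | s≤s z≤n = refl ∷ s

-- Bijections between classes of words.

record Bijection (P Q : Pred (List ℕ) 0ℓ) : Set where
  field
    forth      : List ℕ → List ℕ
    back       : List ℕ → List ℕ
    forth-∈    : ∀ {e} → P e → Q (forth e)
    back-∈     : ∀ {e} → Q e → P (back e)
    back-forth : ∀ {e} → P e → back (forth e) ≡ e
    forth-back : ∀ {e} → Q e → forth (back e) ≡ e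

open Bijection

identity : ∀ {P Q : Pred (List ℕ) 0ℓ} → (∀ {e} → P e → Q e) → (∀ {e} → Q e → P e) → Bijection P Q
identity f g = record
  { forth      = id
  ; back       = id
  ; forth-∈    = f
  ; back-∈     = g
  ; back-forth = λ _ → refl
  ; forth-back = λ _ → refl
  }

_then_ : ∀ {P Q R : Pred (List ℕ) 0ℓ} → Bijection P Q → Bijection Q R → Bijection P R
f then g = record
  { forth      = forth g ∘ forth f
  ; back       = back f ∘ back g
  ; forth-∈    = forth-∈ g ∘ forth-∈ f
  ; back-∈     = back-∈ f ∘ back-∈ g
  ; back-forth = λ p → trans (cong (back f) (back-forth g (forth-∈ f p))) (back-forth f p)
  ; forth-back = λ r → trans (cong (forth g) (forth-back f (back-∈ g r))) (forth-back g r)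
  }

-- Exchanging 01 and 10 one level at a time.

Above : Pred (List ℕ) 0ℓ → ℕ → Pred (List ℕ) 0ℓ
Above S t u = ∃ λ g → g ⊆ u × All (t <_) g × S g

above? : ∀ {S} → Decidable S → ∀ t → Decidable (Above S t)
above? S? t = anySublist? (λ g → All.all? (t <?_) g ×-dec S? g)

Above-anti : ∀ {S a t} → a ≤ t → ∀ {u} → Above S t u → Above S a u
Above-anti a≤t (g , g⊆ , t<g , s) = g , g⊆ , All.map (≤-<-trans a≤t) t<g , s

Copies : ℕ → ℕ → Pred (List ℕ) 0ℓ
Copies k t u = replicate k t ⊆ u

copies? : ∀ k t → Decidable (Copies k t)
copies? k t = replicate k t ⊆?_

-- In α01β and α10β, α consists of letters ≥ 2 in the shape S followed by p letters 1, and β of q letters 1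
-- followed by letters ≥ 2 in the shape S′. The letter 0 stands for a value ≥ c: c = 1 serves the patterns
-- with an additional least letter in front, as which e₁ = 0 can always be taken.
module Levels (c p q : ℕ) {S S′ : Pred (List ℕ) 0ℓ} (S? : Decidable S) (S′? : Decidable S′)
              (anchored : S [] → 0 < p) where

  -- `Low t` holds of the letters that may move at level `t`, `Small t` of the candidates for the
  -- letter 0; letters below `c` stay in place.
  Low Small : ℕ → Pred ℕ 0ℓ
  Low   t x = c ≤ x × x ≤ t
  Small t x = c ≤ x × x < t

  low? : ∀ t → Decidable (Low t)
  low? t x = (c ≤? x) ×-dec (x ≤? t)

  small? : ∀ t → Decidable (Small t)
  small? t x = (c ≤? x) ×-dec (x <? t)

  Has Core Occ : Bool → ℕ → Pred (List ℕ) 0ℓ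
  Has  b t m = ∃ λ x → Small t x × pair b x t ⊆ m
  Core b t = Between (Copies p t) (Copies q t) (Has b t)
  Occ  b t = Between (Above S t) (Above S′ t) (Core b t)

  -- The index `b` names the pair that the result avoids. `φ` locates the frame of the larger
  -- letters, and `ψ` inside it the frame of the copies of `t`.
  rearrange ψ φ : Bool → ℕ → List ℕ → List ℕ
  rearrange b t m = refill (low? t) m (norm b t (filter (low? t) m))
  ψ b t = between (copies? p t) (copies? q t) (rearrange b t)
  φ b t = between (above? S? t) (above? S′? t) (ψ b t)

  norm-low : ∀ b t m → All (Low t) (norm b t (filter (low? t) m))
  norm-low b t m = All-resp-↭ (↭-sym (norm-↭ b t _)) (all-filter (low? t) m)

  filter-rearrange : ∀ b t m → filter (low? t) (rearrange b t m) ≡ norm b t (filter (low? t) m)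
  filter-rearrange b t m = filter-refill (low? t) m (norm-low b t m) (↭-length (norm-↭ b t _))

  rearrange-rearrange : ∀ b b′ t m → rearrange b t (rearrange b′ t m) ≡ rearrange b t m
  rearrange-rearrange b b′ t m = begin
    refill L? (rearrange b′ t m) (norm b t (filter L? (rearrange b′ t m)))
      ≡⟨ cong (refill L? (refill L? m n) ∘ norm b t) (filter-rearrange b′ t m) ⟩
    refill L? (refill L? m n) (norm b t n)
      ≡⟨ refill-refill L? m (norm-low b′ t m) (sym (↭-length (norm-↭ b t n))) ⟩
    refill L? m (norm b t n)
      ≡⟨ cong (refill L? m) (norm-norm b b′ t _) ⟩
    rearrange b t m ∎
    where
    open ≡-Reasoning
    L? = low? t
    n  = norm b′ t (filter L? m)

  pair-low : ∀ b {t x} → Small t x → All (Low t) (pair b x t)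
  pair-low false (c≤x , x<t) = (c≤x , <⇒≤ x<t) ∷ (≤-trans c≤x (<⇒≤ x<t) , ≤-refl) ∷ []
  pair-low true  (c≤x , x<t) = (≤-trans c≤x (<⇒≤ x<t) , ≤-refl) ∷ (c≤x , <⇒≤ x<t) ∷ []

  rearrange-fixed : ∀ b t m → ¬ Has b t m → rearrange b t m ≡ m
  rearrange-fixed b t m ¬has =
    trans (cong (refill (low? t) m) (norm-fixed b (All.map proj₂ lows) avoids)) (refill-filter (low? t) m)
    where
    lows = all-filter (low? t) m
    avoids : ∀ {x} → x < t → ¬ (pair b x t ⊆ filter (low? t) m)
    avoids x<t s = ¬has (_ , (proj₁ (All.lookup lows (Any-resp-⊆ s (x∈pair b))) , x<t) ,
                         ⊆-trans s (filter-⊆ (low? t) m))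

  rearrange-avoids : ∀ b t m → ¬ Has b t (rearrange b t m)
  rearrange-avoids b t m (x , sm@(_ , x<t) , s) = norm-avoids b _ x<t
    (subst (pair b x t ⊆_) (filter-rearrange b t m) (⊆-filter (low? t) (pair-low b sm) s))

  -- Cores at levels below `t` depend on this subsequence only.
  filter-small-rearrange : ∀ b t m → filter (small? t) (rearrange b t m) ≡ filter (small? t) m
  filter-small-rearrange b t m = begin
    filter s? (rearrange b t m)                   ≡⟨ viaLow (rearrange b t m) ⟨
    filter s? (filter (low? t) (rearrange b t m)) ≡⟨ cong (filter s?) (filter-rearrange b t m) ⟩
    filter s? (norm b t w)                        ≡⟨ via< (norm b t w) ⟨
    filter s? (filter (_<? t) (norm b t w))       ≡⟨ cong (filter s?) (filter-norm b t w) ⟩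
    filter s? (filter (_<? t) w)                  ≡⟨ via< w ⟩
    filter s? w                                   ≡⟨ viaLow m ⟩
    filter s? m                                   ∎
    where
    open ≡-Reasoning
    s?     = small? t
    w      = filter (low? t) m
    viaLow = filter-filter s? (low? t) (λ (c≤x , x<t) → c≤x , <⇒≤ x<t)
    via<   = filter-filter s? (_<? t) proj₂

  Close : ℕ → ℕ → ℕ → Set
  Close t x y = x ≡ y ⊎ (Low t x × Low t y)

  φ-close : ∀ b t e → Pointwise (Close t) (φ b t e) e
  φ-close b t = between-pointwise (above? S? t) (above? S′? t) (inj₁ refl)
                  (between-pointwise (copies? p t) (copies? q t) (inj₁ refl)
                    (λ m → refill-pointwise (low? t) m (norm-low b t m)))

  Has-infixClosed : ∀ b t → InfixClosed (Has b t)
  Has-infixClosed b t u v (x , sm , s) = x , sm , ⊆-++⁺ˡ u (⊆-++⁺ʳ v s)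

  Core-infixClosed : ∀ b t → InfixClosed (Core b t)
  Core-infixClosed b t = Between-infixClosed (λ u s → ⊆-++⁺ˡ u s) (λ v s → ⊆-++⁺ʳ v s)

  -- Together with `φ-fixed` this makes `φ true t` and `φ false t` mutually inverse between the
  -- words avoiding 01 and those avoiding 10 at level `t`.
  φ-φ : ∀ b b′ t e → φ b t (φ b′ t e) ≡ φ b t e
  φ-φ b b′ t = between-cong-∘ (above? S? t) (above? S′? t)
    (between-cong-∘ (copies? p t) (copies? q t) (rearrange-rearrange b b′ t))

  φ-fixed : ∀ b t e → ¬ Occ b t e → φ b t e ≡ e
  φ-fixed b t = between-fixed (above? S? t) (above? S′? t)
    (between-fixed (copies? p t) (copies? q t) (rearrange-fixed b t))

  φ-avoids : ∀ b t e → ¬ Occ b t (φ b t e)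
  φ-avoids b t = between-avoids (above? S? t) (above? S′? t) (Core-infixClosed b t)
                   (between-avoids (copies? p t) (copies? q t) (Has-infixClosed b t) (rearrange-avoids b t))

  close-above : ∀ {t g g′} → All (t <_) g → Pointwise (Close t) g g′ → g ≡ g′
  close-above []         []                           = refl
  close-above (_ ∷ t<g)  (inj₁ refl ∷ rs)             = cong (_ ∷_) (close-above t<g rs)
  close-above (t<x ∷ _)  (inj₂ ((_ , x≤t) , _) ∷ rs) = contradiction t<x (≤⇒≯ x≤t)

  Above-close : ∀ {T a t} → t < a → ∀ {u u′} → Pointwise (Close t) u u′ → Above T a u → Above T a u′
  Above-close t<a rs (g , g⊆ , a<g , s) with g′ , g′⊆ , gg′ ← ⊆-Pointwise g⊆ rs
    with refl ← close-above (All.map (<-trans t<a) a<g) gg′ = g , g′⊆ , a<g , s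

  Copies-close : ∀ {k a t} → t < a → ∀ {u u′} → Pointwise (Close t) u u′ → Copies k a u → Copies k a u′
  Copies-close {k} t<a rs s with g′ , g′⊆ , gg′ ← ⊆-Pointwise s rs
    with refl ← close-above (replicate⁺ k t<a) gg′ = g′⊆

  -- The letter `a` exceeds `t` and is fixed; `x` can only be exchanged for a letter from `c` to
  -- `t`, which is again small for `a`.
  pair-close : ∀ b {x a t z} → t < a → Small a x → Pointwise (Close t) (pair b x a) z →
               ∃ λ y → Small a y × z ≡ pair b y a
  pair-close false t<a sm (r ∷ inj₂ ((_ , a≤t) , _) ∷ [])        = contradiction t<a (≤⇒≯ a≤t)
  pair-close false t<a sm (inj₁ refl ∷ inj₁ refl ∷ [])             = _ , sm , refl
  pair-close false t<a sm (inj₂ (_ , c≤y , y≤t) ∷ inj₁ refl ∷ []) = _ , (c≤y , ≤-<-trans y≤t t<a) , refl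
  pair-close true  t<a sm (inj₂ ((_ , a≤t) , _) ∷ r ∷ [])        = contradiction t<a (≤⇒≯ a≤t)
  pair-close true  t<a sm (inj₁ refl ∷ inj₁ refl ∷ [])             = _ , sm , refl
  pair-close true  t<a sm (inj₁ refl ∷ inj₂ (_ , c≤y , y≤t) ∷ []) = _ , (c≤y , ≤-<-trans y≤t t<a) , refl

  Has-close : ∀ {b a t} → t < a → ∀ {u u′} → Pointwise (Close t) u u′ → Has b a u → Has b a u′
  Has-close {b} t<a rs (x , sm , s) with z , z⊆ , pz ← ⊆-Pointwise s rs
    with y , sm′ , refl ← pair-close b t<a sm pz = y , sm′ , z⊆

  Occ-close : ∀ {b a t} → t < a → ∀ {u u′} → Pointwise (Close t) u u′ → Occ b a u → Occ b a u′
  Occ-close t<a = Between-Pointwise (Above-close t<a) (Above-close t<a)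
                    (Between-Pointwise (Copies-close t<a) (Copies-close t<a) (Has-close t<a))

  core : Bool → ℕ → ℕ → List ℕ
  core b a x = replicate p a ++ pair b x a ++ replicate q a

  core-small : ∀ b {a x t} → a < t → Small a x → All (Small t) (core b a x)
  core-small b {a} {x} a<t sm@(c≤x , x<a) =
    ++⁺ (replicate⁺ p sa) (++⁺ (All.map (λ (c≤y , y≤a) → c≤y , ≤-<-trans y≤a a<t) (pair-low b sm))
                               (replicate⁺ q sa))
    where sa = ≤-trans c≤x (<⇒≤ x<a) , a<t

  Core⁻ : ∀ {b a m} → Core b a m → ∃ λ x → Small a x × core b a x ⊆ m
  Core⁻ (split u m v refl ps (x , sm , s) qs) = x , sm , ⊆-++⁺ ps (⊆-++⁺ s qs)

  Core⁺ : ∀ {b a m x} → Small a x → core b a x ⊆ m → Core b a m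
  Core⁺ {b} {a} {x = x} sm s
    with u , w , refl , ps , s′ ← ++-⊆-split (replicate p a) s
    with m , v , refl , s″ , qs ← ++-⊆-split (pair b x a) s′ = split u m v refl ps (x , sm , s″) qs

  -- All letters of the core lie between `c` and `a`, hence are small for `t` and survive the
  -- filter.
  Core-small : ∀ {b a t m m′} → a < t → filter (small? t) m ≡ filter (small? t) m′ → Core b a m → Core b a m′
  Core-small {b} {t = t} {m′ = m′} a<t eq co with x , sm , s ← Core⁻ co =
    Core⁺ sm (⊆-trans (subst (core b _ x ⊆_) eq (⊆-filter (small? t) (core-small b a<t sm) s))
                      (filter-⊆ (small? t) m′))

  -- The ends `x` and `y` of the frame contain the shapes above `t`, hence above `a`. Absorption
  -- moves the larger letters of the occurrence into the unchanged ends; the core around them sees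
  -- only the small letters, whose order is kept.
  Occ-φ-below : ∀ {b b′ a t} → a < t → ∀ e → Occ b a (φ b′ t e) → Occ b a e
  Occ-φ-below {b} {b′} {a} {t} a<t e occ with frame? (above? S? t) (above? S′? t) e
  ... | none _ = occ
  ... | frame x m y refl (px , _) (qy , _)
    with u , x′ , y′ , v , refl , refl , pu , qv , co ←
           Between-absorb (Core-infixClosed b a) (Above-anti (<⇒≤ a<t) px) (Above-anti (<⇒≤ a<t) qy) occ
    = split u (x′ ++ m ++ y′) v (sym (infix-assoc u x′ m y′ v)) pu (Core-small a<t same co) qv
    where
    same : filter (small? t) (x′ ++ ψ b′ t m ++ y′) ≡ filter (small? t) (x′ ++ m ++ y′)
    same = filter-cong-infix (small? t) x′ (ψ b′ t m) m
      (between-filter (copies? p t) (copies? q t) (small? t) (filter-small-rearrange b′ t) m)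

  Occ-φ-other : ∀ {b b′ a t} → a ≢ t → ∀ e → Occ b a (φ b′ t e) → Occ b a e
  Occ-φ-other {b} {b′} {a} {t} a≢t e occ with <-cmp a t
  ... | tri< a<t _ _ = Occ-φ-below {b} {b′} a<t e occ
  ... | tri≈ _ a≡t _ = contradiction a≡t a≢t
  ... | tri> _ _ t<a = Occ-close t<a (φ-close b′ t e) occ

  -- An entry at least `t` sits at a 0-based position at least `t`, so every later position admits
  -- all letters up to `t`.
  Bounded-close : ∀ {t k} u {r r′} → t ≤ k ⊎ Any (t ≤_) u → Pointwise (Close t) r r′ →
                  Bounded k (u ++ r′) → Bounded k (u ++ r)
  Bounded-close [] (inj₁ t≤k) [] bd = tt
  Bounded-close [] (inj₁ t≤k) (inj₁ refl ∷ rs) (x≤k , bd) =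
    x≤k , Bounded-close [] (inj₁ (m≤n⇒m≤1+n t≤k)) rs bd
  Bounded-close [] (inj₁ t≤k) (inj₂ ((_ , x≤t) , _) ∷ rs) (_ , bd) =
    ≤-trans x≤t t≤k , Bounded-close [] (inj₁ (m≤n⇒m≤1+n t≤k)) rs bd
  Bounded-close (a ∷ u) (inj₁ t≤k) rs (a≤k , bd) =
    a≤k , Bounded-close u (inj₁ (m≤n⇒m≤1+n t≤k)) rs bd
  Bounded-close (a ∷ u) (inj₂ (here t≤a)) rs (a≤k , bd) =
    a≤k , Bounded-close u (inj₁ (m≤n⇒m≤1+n (≤-trans t≤a a≤k))) rs bd
  Bounded-close (a ∷ u) (inj₂ (there any)) rs (a≤k , bd) =
    a≤k , Bounded-close u (inj₂ any) rs bd

  -- Such an entry is a letter of the shape `S` or, if the shape is empty, one of the `p` copies of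
  -- `t`, which exist by `anchored`.
  anchor : ∀ {t} x {x′} → Above S t x → Copies p t x′ → Any (t ≤_) (x ++ x′)
  anchor x ([] , _ , _ , s) ps = Any.++⁺ʳ x (Any-resp-⊆ ps (Any-replicate (anchored s)))
    where
    Any-replicate : ∀ {k t} → 0 < k → Any (t ≤_) (replicate k t)
    Any-replicate {suc _} _ = here ≤-refl
  anchor x (a ∷ g , g⊆ , t<a ∷ _ , _) ps = Any.++⁺ˡ (Any-resp-⊆ g⊆ (here (<⇒≤ t<a)))

  φ-bounded : ∀ b t e → Bounded 0 e → Bounded 0 (φ b t e)
  φ-bounded b t e bd with frame? (above? S? t) (above? S′? t) e
  ... | none _ = bd
  ... | frame x m y refl (px , _) _ with frame? (copies? p t) (copies? q t) m
  ...   | none _ = bd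
  ...   | frame x′ m′ y′ refl (ps , _) _ =
    subst (Bounded 0) (sym (infix-assoc x x′ (rearrange b t m′) y′ y))
      (Bounded-close (x ++ x′) (inj₂ (anchor x px ps))
        (Pw.++⁺ (refill-pointwise (low? t) m′ (norm-low b t m′)) (Pw.refl (inj₁ refl)))
        (subst (Bounded 0) (infix-assoc x x′ m′ y′ y) bd))

  φ-invseq : ∀ {n} b t e → Invseq n e → Invseq n (φ b t e)
  φ-invseq b t e (len , bd) = trans (Pw.Pointwise-length (φ-close b t e)) len , φ-bounded b t e bd

  -- 10 is avoided at the levels below s, 01 at the others.
  Hybrid : ℕ → ℕ → Pred (List ℕ) 0ℓ
  Hybrid n s e = Invseq n e × ∀ a → ¬ Occ (a <ᵇ s) a e

  -- Only level `s` changes sides: there `φ-avoids` gives the new condition, and `Occ-φ-other`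
  -- preserves the condition at all other levels.
  step : ∀ n s → Bijection (Hybrid n s) (Hybrid n (suc s))
  step n s = record
    { forth      = φ true s
    ; back       = φ false s
    ; forth-∈    = λ {e} (inv , av) → φ-invseq true s e inv , forth-avoids e av
    ; back-∈     = λ {e} (inv , av) → φ-invseq false s e inv , back-avoids e av
    ; back-forth = λ {e} (_ , av) → trans (φ-φ false true s e)
        (φ-fixed false s e (subst (λ b → ¬ Occ b s e) (<ᵇ-self s) (av s)))
    ; forth-back = λ {e} (_ , av) → trans (φ-φ true false s e)
        (φ-fixed true s e (subst (λ b → ¬ Occ b s e) (<ᵇ-suc-self s) (av s)))
    }
    where
    forth-avoids : ∀ e → (∀ a → ¬ Occ (a <ᵇ s) a e) → ∀ a → ¬ Occ (a <ᵇ suc s) a (φ true s e)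
    forth-avoids e av a with a ≟ s
    ... | yes refl rewrite <ᵇ-suc-self s = φ-avoids true s e
    ... | no a≢s rewrite <ᵇ-suc a≢s = av a ∘ Occ-φ-other {b′ = true} a≢s e
    back-avoids : ∀ e → (∀ a → ¬ Occ (a <ᵇ suc s) a e) → ∀ a → ¬ Occ (a <ᵇ s) a (φ false s e)
    back-avoids e av a with a ≟ s
    ... | yes refl rewrite <ᵇ-self s = φ-avoids false s e
    ... | no a≢s rewrite sym (<ᵇ-suc a≢s) = av a ∘ Occ-φ-other {b′ = false} a≢s e

  steps : ∀ n s → Bijection (Hybrid n 0) (Hybrid n s)
  steps n zero    = identity id id
  steps n (suc s) = steps n s then step n s

  Avoiding : Bool → ℕ → Pred (List ℕ) 0ℓ
  Avoiding b n e = Invseq n e × ∀ a → ¬ Occ b a e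

  Occ-∈ : ∀ b {a e} → Occ b a e → a ∈ e
  Occ-∈ b {a} (split u m v refl _ (split u′ m′ v′ refl _ (x , _ , s) _) _) =
    Any.++⁺ʳ u (Any.++⁺ˡ (Any.++⁺ʳ u′ (Any.++⁺ˡ (Any-resp-⊆ s (t∈pair b)))))

  -- `Hybrid n 0` is `Avoiding false n` by computation. After `n` steps all levels are done, since
  -- an occurrence at level `a` uses the entry `a`, which is less than `n`.
  avoiding-bijection : ∀ n → Bijection (Avoiding false n) (Avoiding true n)
  avoiding-bijection n = steps n n then identity
    (λ {e} ((len , bd) , av) → (len , bd) ,
      λ a occ → av a (subst (λ b → Occ b a e) (sym (<ᵇ-true (a<n len bd (Occ-∈ true occ)))) occ))
    (λ {e} ((len , bd) , av) → (len , bd) ,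
      λ a occ → av a (subst (λ b → Occ b a e) (<ᵇ-true (a<n len bd (Occ-∈ (a <ᵇ n) occ))) occ))
    where
    a<n : ∀ {a e} → length e ≡ n → Bounded 0 e → a ∈ e → a < n
    a<n {e = e} refl bd a∈ = Bounded-< e bd a∈

  -- The occurrence as one explicit subsequence, the form that compares with patterns; `Occ`
  -- expresses it by cuts, as the frames require.
  data Word (b : Bool) (a : ℕ) (e : List ℕ) : Set where
    word : ∀ {g h x} → All (a <_) g → S g → All (a <_) h → S′ h → Small a x →
           g ++ core b a x ++ h ⊆ e → Word b a e

  Word⇒Occ : ∀ {b a e} → Word b a e → Occ b a e
  Word⇒Occ {b} {a} (word {g} {h} {x} a<g s a<h s′ sm w⊆)
    with u , w , refl , g⊆ , w⊆′ ← ++-⊆-split g w⊆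
    with m , v , refl , m⊆ , h⊆ ← ++-⊆-split (core b a x) w⊆′
    = split u m v refl (g , g⊆ , a<g , s) (Core⁺ sm m⊆) (h , h⊆ , a<h , s′)

  Occ⇒Word : ∀ {b a e} → Occ b a e → Word b a e
  Occ⇒Word (split u m v refl (g , g⊆ , a<g , s) co (h , h⊆ , a<h , s′)) with x , sm , m⊆ ← Core⁻ co =
    word a<g s a<h s′ sm (⊆-++⁺ g⊆ (⊆-++⁺ m⊆ h⊆))

  represents : ∀ {k} b {π : Vec ℕ k} → (∀ {e} → Occurrence π e → ∃ λ a → Word b a e) →
               (∀ {a e} → Word b a e → ∃ λ f → StrictMono f × toList (Vec.map f π) ⊆ e) →
               Represents (Occ b) π
  represents b {π} to′ from′ = mkRepresents λ e _ → mk⇔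
    (λ co → let a , w = to′ (Contains⇒Occurrence co) in a , Word⇒Occ w)
    (λ (a , occ) → let f , mono , s = from′ (Occ⇒Word occ) in ⊆⇒Contains π mono s)

  -- `Word` describes the pattern without its leading 0, which `prepend-zero` restores.
  represents-0∷ : ∀ {k} b {π : Vec ℕ k} → (∀ {e} → Occurrence (0 ∷ π) e → ∃ λ a → Word b a e) →
                  (∀ {a e} → Word b a e →
                     ∃ λ f → StrictMono f × f 0 ≡ 0 ×
                     ∃₂ λ y w → toList (Vec.map f π) ≡ y ∷ w × 0 < y × y ∷ w ⊆ e) →
                  Represents (Occ b) (0 ∷ π)
  represents-0∷ b {π} to′ from′ = mkRepresents λ e inv → mk⇔
    (λ co → let a , w = to′ (Contains⇒Occurrence co) in a , Word⇒Occ w)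
    λ (a , occ) → let f , mono , f0≡0 , y , w , π≡ , 0<y , s = from′ (Occ⇒Word occ) in
      ⊆⇒Contains (0 ∷ π) mono (subst (_⊆ toList e) (sym (cong₂ _∷_ f0≡0 π≡)) (prepend-zero e inv 0<y s))

  Avoiding⇒∈ : ∀ {k n} b (π : Vec ℕ k) → Represents (Occ b) π → ∀ {l} → Avoiding b n l →
               l ∈ List.map toList (𝐈-avoiding n π)
  Avoiding⇒∈ b π rep {l} ((len , bd) , av) with e , refl ← toVec l len =
    ∈-map⁺ toList (from (𝐈-avoiding-complete π e) (inv ,
      λ co → let a , occ = to (contains⇔ rep e inv) co in av a occ))
    where inv = Bounded⇒IsInversionSequence 0 e bd

  ∈⇒Avoiding : ∀ {k n} b (π : Vec ℕ k) → Represents (Occ b) π → ∀ {l} →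
               l ∈ List.map toList (𝐈-avoiding n π) → Avoiding b n l
  ∈⇒Avoiding b π rep l∈
    with e , e∈ , refl ← ∈-map⁻ toList l∈
    with inv , av ← to (𝐈-avoiding-complete π e) e∈ =
    (length-toList e , IsInversionSequence⇒Bounded 0 e inv) , λ a occ → av (from (contains⇔ rep e inv) (a , occ))

  -- Two inequalities: each avoider of one pattern is the image, under one direction of the
  -- bijection, of an avoider of the other, and the lists have no repetitions.
  wilf : ∀ {k l} b (π : Vec ℕ k) (σ : Vec ℕ l) →
         Represents (Occ b) π → Represents (Occ (not b)) σ → π ≡ᵂ σ
  wilf true  π σ repπ repσ n n≥1 = sym (wilf false σ π repσ repπ n n≥1)
  wilf false π σ repπ repσ n _ = ≤-antisym
    (inject (Unique.map⁺ toList-inj (𝐈-avoiding-unique n π)) (back bij) λ l∈ →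
      let l-av = ∈⇒Avoiding false π repπ l∈ in
      forth bij _ , Avoiding⇒∈ true σ repσ (forth-∈ bij l-av) , sym (back-forth bij l-av))
    (inject (Unique.map⁺ toList-inj (𝐈-avoiding-unique n σ)) (forth bij) λ l∈ →
      let l-av = ∈⇒Avoiding true σ repσ l∈ in
      back bij _ , Avoiding⇒∈ false π repπ (back-∈ bij l-av) , sym (forth-back bij l-av))
    where
    bij = avoiding-bijection n
    inject : ∀ {xs ys : List (Vec ℕ n)} → Unique (List.map toList xs) → (g : List ℕ → List ℕ) →
             (∀ {l} → l ∈ List.map toList xs → ∃ λ l′ → l′ ∈ List.map toList ys × l ≡ g l′) →
             length xs ≤ length ys
    inject {xs} {ys} uniq g covered = subst₂ _≤_ (length-map toList xs)
      (trans (length-map g (List.map toList ys)) (length-map toList ys))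
      (Unique-length-≤ uniq λ l∈ → let l′ , l′∈ , l≡ = covered l∈ in subst (_∈ _) (sym l≡) (∈-map⁺ g l′∈))

-- Shapes of the larger letters, and the individual equivalences.

data Empty : Pred (List ℕ) 0ℓ where
  empty : Empty []

data One : Pred (List ℕ) 0ℓ where
  one : ∀ {y} → One (y ∷ [])

data Two (R : Rel ℕ 0ℓ) : Pred (List ℕ) 0ℓ where
  two : ∀ {y z} → R y z → Two R (y ∷ z ∷ [])

empty? : Decidable Empty
empty? []      = yes empty
empty? (_ ∷ _) = no λ ()

one? : Decidable One
one? []          = no λ ()
one? (_ ∷ [])    = yes one
one? (_ ∷ _ ∷ _) = no λ ()

two? : ∀ {R} → Binary.Decidable R → Decidable (Two R)
two? R? []              = no λ ()
two? R? (_ ∷ [])        = no λ ()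
two? R? (y ∷ z ∷ [])    = map′ two (λ { (two r) → r }) (R? y z)
two? R? (_ ∷ _ ∷ _ ∷ _) = no λ ()

-- Decomposed as 1·01·1 and 1·10·1.
1011≡ᵂ1101 : 1 ∷ 0 ∷ 1 ∷ 1 ∷ [] ≡ᵂ 1 ∷ 1 ∷ 0 ∷ 1 ∷ []
1011≡ᵂ1101 = wilf false (1 ∷ 0 ∷ 1 ∷ 1 ∷ []) (1 ∷ 1 ∷ 0 ∷ 1 ∷ [])
  (represents false
    (λ { (occurrence (a ∷ x ∷ _ ∷ _ ∷ []) s lt eq) →
      case (eq 0F 2F , eq 0F 3F) of λ { (refl , refl) →
      _ , word [] empty [] empty (z≤n , lt 1F 0F) s } })
    (λ { (word [] empty [] empty (_ , x<a) s) →
      -- The pattern uses only the letters 0 and 1; the values at 2 and 3 are fillers.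
      _ , chain-mono x<a (n<1+n _) (n<1+n _) , s }))
  (represents true
    (λ { (occurrence (a ∷ _ ∷ x ∷ _ ∷ []) s lt eq) →
      case (eq 0F 1F , eq 0F 3F) of λ { (refl , refl) →
      _ , word [] empty [] empty (z≤n , lt 2F 0F) s } })
    (λ { (word [] empty [] empty (_ , x<a) s) →
      _ , chain-mono x<a (n<1+n _) (n<1+n _) , s }))
  where open Levels 0 1 1 empty? empty? (λ _ → z<s)

-- Decomposed as 11·01 and 11·10.
1101≡ᵂ1110 : 1 ∷ 1 ∷ 0 ∷ 1 ∷ [] ≡ᵂ 1 ∷ 1 ∷ 1 ∷ 0 ∷ []
1101≡ᵂ1110 = wilf false (1 ∷ 1 ∷ 0 ∷ 1 ∷ []) (1 ∷ 1 ∷ 1 ∷ 0 ∷ [])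
  (represents false
    (λ { (occurrence (a ∷ _ ∷ x ∷ _ ∷ []) s lt eq) →
      case (eq 0F 1F , eq 0F 3F) of λ { (refl , refl) →
      _ , word [] empty [] empty (z≤n , lt 2F 0F) s } })
    (λ { (word [] empty [] empty (_ , x<a) s) →
      _ , chain-mono x<a (n<1+n _) (n<1+n _) , s }))
  (represents true
    (λ { (occurrence (a ∷ _ ∷ _ ∷ x ∷ []) s lt eq) →
      case (eq 0F 1F , eq 0F 2F) of λ { (refl , refl) →
      _ , word [] empty [] empty (z≤n , lt 3F 0F) s } })
    (λ { (word [] empty [] empty (_ , x<a) s) →
      _ , chain-mono x<a (n<1+n _) (n<1+n _) , s }))
  where open Levels 0 2 0 empty? empty? (λ _ → z<s)

-- Decomposed as 21·10 and 21·01.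
2110≡ᵂ2101 : 2 ∷ 1 ∷ 1 ∷ 0 ∷ [] ≡ᵂ 2 ∷ 1 ∷ 0 ∷ 1 ∷ []
2110≡ᵂ2101 = wilf true (2 ∷ 1 ∷ 1 ∷ 0 ∷ []) (2 ∷ 1 ∷ 0 ∷ 1 ∷ [])
  (represents true
    (λ { (occurrence (_ ∷ a ∷ _ ∷ x ∷ []) s lt eq) →
      case eq 1F 2F of λ { refl →
      _ , word (lt 1F 0F ∷ []) one [] empty (z≤n , lt 3F 1F) s } })
    (λ { (word (a<y ∷ []) one [] empty (_ , x<a) s) →
      _ , chain-mono x<a a<y (n<1+n _) , s }))
  (represents false
    (λ { (occurrence (_ ∷ a ∷ x ∷ _ ∷ []) s lt eq) →
      case eq 1F 3F of λ { refl →
      _ , word (lt 1F 0F ∷ []) one [] empty (z≤n , lt 2F 1F) s } })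
    (λ { (word (a<y ∷ []) one [] empty (_ , x<a) s) →
      _ , chain-mono x<a a<y (n<1+n _) , s }))
  where open Levels 0 1 0 one? empty? (λ _ → z<s)

-- Decomposed as 2·10·1 and 2·01·1; here the letter 2 is the anchor.
2101≡ᵂ2011 : 2 ∷ 1 ∷ 0 ∷ 1 ∷ [] ≡ᵂ 2 ∷ 0 ∷ 1 ∷ 1 ∷ []
2101≡ᵂ2011 = wilf true (2 ∷ 1 ∷ 0 ∷ 1 ∷ []) (2 ∷ 0 ∷ 1 ∷ 1 ∷ [])
  (represents true
    (λ { (occurrence (_ ∷ a ∷ x ∷ _ ∷ []) s lt eq) →
      case eq 1F 3F of λ { refl →
      _ , word (lt 1F 0F ∷ []) one [] empty (z≤n , lt 2F 1F) s } })
    (λ { (word (a<y ∷ []) one [] empty (_ , x<a) s) →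
      _ , chain-mono x<a a<y (n<1+n _) , s }))
  (represents false
    (λ { (occurrence (_ ∷ x ∷ a ∷ _ ∷ []) s lt eq) →
      case eq 2F 3F of λ { refl →
      _ , word (lt 2F 0F ∷ []) one [] empty (z≤n , lt 1F 2F) s } })
    (λ { (word (a<y ∷ []) one [] empty (_ , x<a) s) →
      _ , chain-mono x<a a<y (n<1+n _) , s }))
  where open Levels 0 0 1 one? empty? (λ ())

-- Behind the leading 0 stand 1·10 and 1·01 with letters raised by one; `c = 1` keeps the smaller
-- letter of the pair positive.
0221≡ᵂ0212 : 0 ∷ 2 ∷ 2 ∷ 1 ∷ [] ≡ᵂ 0 ∷ 2 ∷ 1 ∷ 2 ∷ []
0221≡ᵂ0212 = wilf true (0 ∷ 2 ∷ 2 ∷ 1 ∷ []) (0 ∷ 2 ∷ 1 ∷ 2 ∷ [])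
  (represents-0∷ true
    (λ { (occurrence (_ ∷ a ∷ _ ∷ x ∷ []) s lt eq) →
      case eq 1F 2F of λ { refl →
      _ , word [] empty [] empty (≤-<-trans z≤n (lt 0F 3F) , lt 3F 1F) (∷ˡ⁻ s) } })
    (λ { (word [] empty [] empty (0<x , x<a) s) →
      _ , chain-mono 0<x x<a (n<1+n _) , refl , _ , _ , refl , <-trans 0<x x<a , s }))
  (represents-0∷ false
    (λ { (occurrence (_ ∷ a ∷ x ∷ _ ∷ []) s lt eq) →
      case eq 1F 3F of λ { refl →
      _ , word [] empty [] empty (≤-<-trans z≤n (lt 0F 2F) , lt 2F 1F) (∷ˡ⁻ s) } })
    (λ { (word [] empty [] empty (0<x , x<a) s) →
      _ , chain-mono 0<x x<a (n<1+n _) , refl , _ , _ , refl , <-trans 0<x x<a , s }))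
  where open Levels 1 1 0 empty? empty? (λ _ → z<s)

-- Behind the leading 0 stand 2·01 and 2·10 with letters raised by one.
0312≡ᵂ0321 : 0 ∷ 3 ∷ 1 ∷ 2 ∷ [] ≡ᵂ 0 ∷ 3 ∷ 2 ∷ 1 ∷ []
0312≡ᵂ0321 = wilf false (0 ∷ 3 ∷ 1 ∷ 2 ∷ []) (0 ∷ 3 ∷ 2 ∷ 1 ∷ [])
  (represents-0∷ false
    (λ { (occurrence (_ ∷ _ ∷ x ∷ a ∷ []) s lt eq) →
      _ , word (lt 3F 1F ∷ []) one [] empty (≤-<-trans z≤n (lt 0F 2F) , lt 2F 3F) (∷ˡ⁻ s) })
    (λ { (word (a<y ∷ []) one [] empty (0<x , x<a) s) →
      _ , chain-mono 0<x x<a a<y , refl , _ , _ , refl , <-trans 0<x (<-trans x<a a<y) , s }))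
  (represents-0∷ true
    (λ { (occurrence (_ ∷ _ ∷ a ∷ x ∷ []) s lt eq) →
      _ , word (lt 2F 1F ∷ []) one [] empty (≤-<-trans z≤n (lt 0F 3F) , lt 3F 2F) (∷ˡ⁻ s) })
    (λ { (word (a<y ∷ []) one [] empty (0<x , x<a) s) →
      _ , chain-mono 0<x x<a a<y , refl , _ , _ , refl , <-trans 0<x (<-trans x<a a<y) , s }))
  where open Levels 1 0 0 one? empty? (λ ())

-- Decomposed as 1·10·2 and 1·01·2, with a larger letter on the right.
1102≡ᵂ1012 : 1 ∷ 1 ∷ 0 ∷ 2 ∷ [] ≡ᵂ 1 ∷ 0 ∷ 1 ∷ 2 ∷ []
1102≡ᵂ1012 = wilf true (1 ∷ 1 ∷ 0 ∷ 2 ∷ []) (1 ∷ 0 ∷ 1 ∷ 2 ∷ [])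
  (represents true
    (λ { (occurrence (a ∷ _ ∷ x ∷ _ ∷ []) s lt eq) →
      case eq 0F 1F of λ { refl →
      _ , word [] empty (lt 0F 3F ∷ []) one (z≤n , lt 2F 0F) s } })
    (λ { (word [] empty (a<y ∷ []) one (_ , x<a) s) →
      _ , chain-mono x<a a<y (n<1+n _) , s }))
  (represents false
    (λ { (occurrence (a ∷ x ∷ _ ∷ _ ∷ []) s lt eq) →
      case eq 0F 2F of λ { refl →
      _ , word [] empty (lt 0F 3F ∷ []) one (z≤n , lt 1F 0F) s } })
    (λ { (word [] empty (a<y ∷ []) one (_ , x<a) s) →
      _ , chain-mono x<a a<y (n<1+n _) , s }))
  where open Levels 0 1 0 empty? one? (λ _ → z<s)

2201≡ᵂ2210 : 2 ∷ 2 ∷ 0 ∷ 1 ∷ [] ≡ᵂ 2 ∷ 2 ∷ 1 ∷ 0 ∷ []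
2201≡ᵂ2210 = wilf false (2 ∷ 2 ∷ 0 ∷ 1 ∷ []) (2 ∷ 2 ∷ 1 ∷ 0 ∷ [])
  (represents false
    (λ { (occurrence (_ ∷ _ ∷ x ∷ a ∷ []) s lt eq) →
      case eq 0F 1F of λ { refl →
      _ , word (lt 3F 0F ∷ lt 3F 0F ∷ []) (two refl) [] empty (z≤n , lt 2F 3F) s } })
    (λ { (word (a<y ∷ _) (two refl) [] empty (_ , x<a) s) →
      _ , chain-mono x<a a<y (n<1+n _) , s }))
  (represents true
    (λ { (occurrence (_ ∷ _ ∷ a ∷ x ∷ []) s lt eq) →
      case eq 0F 1F of λ { refl →
      _ , word (lt 2F 0F ∷ lt 2F 0F ∷ []) (two refl) [] empty (z≤n , lt 3F 2F) s } })
    (λ { (word (a<y ∷ _) (two refl) [] empty (_ , x<a) s) →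
      _ , chain-mono x<a a<y (n<1+n _) , s }))
  where open Levels 0 0 0 (two? _≟_) empty? (λ ())

2301≡ᵂ2310 : 2 ∷ 3 ∷ 0 ∷ 1 ∷ [] ≡ᵂ 2 ∷ 3 ∷ 1 ∷ 0 ∷ []
2301≡ᵂ2310 = wilf false (2 ∷ 3 ∷ 0 ∷ 1 ∷ []) (2 ∷ 3 ∷ 1 ∷ 0 ∷ [])
  (represents false
    (λ { (occurrence (_ ∷ _ ∷ x ∷ a ∷ []) s lt eq) →
      _ , word (lt 3F 0F ∷ lt 3F 1F ∷ []) (two (lt 0F 1F)) [] empty (z≤n , lt 2F 3F) s })
    (λ { (word (a<y ∷ _) (two r) [] empty (_ , x<a) s) →
      _ , chain-mono x<a a<y r , s }))
  (represents true
    (λ { (occurrence (_ ∷ _ ∷ a ∷ x ∷ []) s lt eq) →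
      _ , word (lt 2F 0F ∷ lt 2F 1F ∷ []) (two (lt 0F 1F)) [] empty (z≤n , lt 3F 2F) s })
    (λ { (word (a<y ∷ _) (two r) [] empty (_ , x<a) s) →
      _ , chain-mono x<a a<y r , s }))
  where open Levels 0 0 0 (two? _<?_) empty? (λ ())

3201≡ᵂ3210 : 3 ∷ 2 ∷ 0 ∷ 1 ∷ [] ≡ᵂ 3 ∷ 2 ∷ 1 ∷ 0 ∷ []
3201≡ᵂ3210 = wilf false (3 ∷ 2 ∷ 0 ∷ 1 ∷ []) (3 ∷ 2 ∷ 1 ∷ 0 ∷ [])
  (represents false
    (λ { (occurrence (_ ∷ _ ∷ x ∷ a ∷ []) s lt eq) →
      _ , word (lt 3F 0F ∷ lt 3F 1F ∷ []) (two (lt 1F 0F)) [] empty (z≤n , lt 2F 3F) s })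
    -- The shape is decreasing, so its second letter plays the role of 2 and bounds `a` in the
    -- chain.
    (λ { (word (_ ∷ a<y ∷ []) (two r) [] empty (_ , x<a) s) →
      _ , chain-mono x<a a<y r , s }))
  (represents true
    (λ { (occurrence (_ ∷ _ ∷ a ∷ x ∷ []) s lt eq) →
      _ , word (lt 2F 0F ∷ lt 2F 1F ∷ []) (two (lt 1F 0F)) [] empty (z≤n , lt 3F 2F) s })
    (λ { (word (_ ∷ a<y ∷ []) (two r) [] empty (_ , x<a) s) →
      _ , chain-mono x<a a<y r , s }))
  where open Levels 0 0 0 (two? _>?_) empty? (λ ())

theorem1p1 :
    (1 ∷ 0 ∷ 1 ∷ 1 ∷ [] ≡ᵂ 1 ∷ 1 ∷ 0 ∷ 1 ∷ []) ×
    (1 ∷ 1 ∷ 0 ∷ 1 ∷ [] ≡ᵂ 1 ∷ 1 ∷ 1 ∷ 0 ∷ []) ×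
    (2 ∷ 1 ∷ 1 ∷ 0 ∷ [] ≡ᵂ 2 ∷ 1 ∷ 0 ∷ 1 ∷ []) ×
    (2 ∷ 1 ∷ 0 ∷ 1 ∷ [] ≡ᵂ 2 ∷ 0 ∷ 1 ∷ 1 ∷ []) ×
    (0 ∷ 2 ∷ 2 ∷ 1 ∷ [] ≡ᵂ 0 ∷ 2 ∷ 1 ∷ 2 ∷ []) ×
    (0 ∷ 3 ∷ 1 ∷ 2 ∷ [] ≡ᵂ 0 ∷ 3 ∷ 2 ∷ 1 ∷ []) ×
    (1 ∷ 1 ∷ 0 ∷ 2 ∷ [] ≡ᵂ 1 ∷ 0 ∷ 1 ∷ 2 ∷ []) ×
    (2 ∷ 2 ∷ 0 ∷ 1 ∷ [] ≡ᵂ 2 ∷ 2 ∷ 1 ∷ 0 ∷ []) ×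
    (2 ∷ 3 ∷ 0 ∷ 1 ∷ [] ≡ᵂ 2 ∷ 3 ∷ 1 ∷ 0 ∷ []) ×
    (3 ∷ 2 ∷ 0 ∷ 1 ∷ [] ≡ᵂ 3 ∷ 2 ∷ 1 ∷ 0 ∷ [])
theorem1p1 =
  1011≡ᵂ1101 , 1101≡ᵂ1110 , 2110≡ᵂ2101 , 2101≡ᵂ2011 , 0221≡ᵂ0212 ,
  0312≡ᵂ0321 , 1102≡ᵂ1012 , 2201≡ᵂ2210 , 2301≡ᵂ2310 , 3201≡ᵂ3210
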